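{- Let $M$ be a polyhedral map with $n$ vertices and let $K$ be its dual map. Then the edge graph $EG(K)$ contains a proper tree if and only if $EG(K)$ contains a proper graph of type-II.
   Context: A map on a surface is an embedding of a finite simple graph in a connected closed surface such that the closure of each complementary component is a $p$-gonal 2-disc ($p\ge3$), the faces; it is polyhedral if any two faces meet in the empty set, a vertex or an edge. $EG(\cdot)$ is the edge graph. The dual map $K$ of $M$ has one vertex per face of $M$ and, for each edge of $M$, an edge joining the vertices of the two faces containing it; faces of $K$ correspond to vertices of $M$. Write $V_K,E_K,F_K$ for vertices, edges, faces of $K$; for a face $F$ of $K$ and an edge set $E$, $F\cap E$ is the set of edges of $E$ on the boundary of $F$. A tree $T$ in $EG(K)$ with vertex set $\{v_1,\dots,v_k\}$ is a proper tree if: (1) $\sum_{i=1}^k\deg(v_i)=n+2(k-1)$, degrees taken in $EG(K)$; (2) whenever two vertices $u_1,u_2$ of $T$ lie on a face $F$ of $K$, a path joining them in the boundary of $F$ is a subtree of $T$; (3) any path in $T$ lying in a face $F$ of $K$ has length at most $q-2$, where $q$ is the length of the boundary of $F$. A subgraph $G=(V,E)$ of $EG(K)$ is admissible if: (1) $|E|=n$; (2) for each face $F$ of $K$, $F\cap E$ consists of exactly two edges; (3) there is a sequence of $n$ faces $F_1,\dots,F_n$ of $K$ with $F_i\cap F_{i+1}\in E$ for $1\le i\le n-1$ and $F_1\cap F_n\in E$. An admissible $G$ is a proper graph of type-II if $(V_K,E_K\setminus E)$ has exactly two connected components, one of which is a proper tree. -}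

module Defs where

open import Data.Nat using (ℕ; zero; suc; _+_; _*_; _∸_; _≤_)
open import Data.Fin using (Fin)
open import Data.Fin.Properties using (any?) renaming (_≟_ to _≟F_)
open import Data.List using (List; []; _∷_; _++_; allFin; length; map; filter; head; last)
open import Data.List.Membership.Propositional using (_∈_; _∉_)
open import Data.List.Relation.Unary.All using (All)
open import Data.List.Relation.Unary.Unique.Propositional using (Unique)
open import Data.Maybe using (just)
open import Data.Nat.ListAction using (sum)
open import Data.Product using (Σ; ∃; ∃₂; _×_; _,_)
open import Data.Product.Properties using (≡-dec)
open import Data.Sum using (_⊎_)
open import Data.Empty using (⊥)
open import Function.Bundles using (_⇔_)
open import Relation.Binary.PropositionalEquality using (_≡_; _≢_)
open import Relation.Binary.Construct.Closure.ReflexiveTransitive using (Star)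
open import Relation.Nullary using (Dec; ¬_)
import Relation.Nullary.Decidable as Dec
import Data.List.Membership.DecPropositional as DecMem
import Relation.Nullary.Decidable.Core as DC

_∈ₚ?_ : {k : ℕ} (x : Fin k × Fin k) (xs : List (Fin k × Fin k)) → Dec (x ∈ xs)
_∈ₚ?_ = DecMem._∈?_ (≡-dec _≟F_ _≟F_)

pairs : {A : Set} → List A → List (A × A)
pairs []           = []
pairs (x ∷ [])     = []
pairs (x ∷ y ∷ xs) = (x , y) ∷ pairs (y ∷ xs)

cpairs : {A : Set} → List A → List (A × A)
cpairs []       = []
cpairs (x ∷ xs) = pairs ((x ∷ xs) ++ (x ∷ []))

-- Combinatorial data of a map with vertex set Fin nv and face set Fin nf:
-- each face is given by its boundary cycle, a cyclic list of vertices.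
-- The edge graph consists of the pairs of vertices consecutive on some
-- face boundary (so the underlying graph is automatically simple).

record Map (nv nf : ℕ) : Set where
  field
    face : Fin nf → List (Fin nv)
open Map public

module _ {nv nf : ℕ} (M : Map nv nf) where

  OnBoundary : Fin nf → Fin nv → Fin nv → Set
  OnBoundary f u v = (u , v) ∈ cpairs (face M f) ⊎ (v , u) ∈ cpairs (face M f)

  Adj : Fin nv → Fin nv → Set
  Adj u v = ∃ λ f → OnBoundary f u v

  MeetInEdge : Fin nf → Fin nf → Fin nv → Fin nv → Set
  MeetInEdge f g a b =
    OnBoundary f a b × OnBoundary g a b ×
    (∀ w → w ∈ face M f → w ∈ face M g → w ≡ a ⊎ w ≡ b)

  -- M is a map on a connected closed surface:
  --  * every face is a p-gon (p ≥ 3) with distinct boundary vertices;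
  --  * every edge lies in exactly two faces;
  --  * around every vertex v the faces containing v form a single cycle
  --    (consecutive ones share an edge through v), i.e. v has a disc
  --    neighbourhood;
  --  * the edge graph is connected.
  IsMap : Set
  IsMap =
    (∀ f → 3 ≤ length (face M f) × Unique (face M f)) ×
    (∀ u v → Adj u v →
       ∃₂ λ f g → f ≢ g × OnBoundary f u v × OnBoundary g u v ×
         (∀ h → OnBoundary h u v → h ≡ f ⊎ h ≡ g)) ×
    (∀ v → ∃ λ (L : List (Fin nf)) → 1 ≤ length L × Unique L ×
       (∀ f → (f ∈ L) ⇔ (v ∈ face M f)) ×
       (∀ f g → (f , g) ∈ cpairs L → ∃ λ u → OnBoundary f v u × OnBoundary g v u)) ×
    (∀ u v → Star Adj u v)

  Polyhedral : Set
  Polyhedral = ∀ f g → f ≢ g →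
    (∀ w → w ∈ face M f → w ∈ face M g → ⊥) ⊎
    (∃ λ u → ∀ w → w ∈ face M f → w ∈ face M g → w ≡ u) ⊎
    (∃₂ λ a b → MeetInEdge f g a b)

  adj? : ∀ u v → Dec (Adj u v)
  adj? u v = any? λ f → DC._⊎-dec_ ((u , v) ∈ₚ? cpairs (face M f)) ((v , u) ∈ₚ? cpairs (face M f))

  degree : Fin nv → ℕ
  degree v = length (filter (adj? v) (allFin nv))

IsDual : {n m : ℕ} → Map n m → Map m n → Set
IsDual M K =
  (∀ j → Unique (face K j)) ×
  (∀ j f → (f ∈ face K j) ⇔ (j ∈ face M f)) ×
  (∀ j f g → (f , g) ∈ cpairs (face K j) →
     ∃ λ u → OnBoundary M f j u × OnBoundary M g j u) ×
  (∀ f g → Adj K f g ⇔ (f ≢ g × ∃₂ λ u v → OnBoundary M f u v × OnBoundary M g u v))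

-- Subgraphs of EG(K) are given by lists of (oriented representatives of)
-- edges.  K : Map m n has n faces (n = number of vertices of M).

module _ {m n : ℕ} (K : Map m n) where

  EdgeOf : List (Fin m × Fin m) → Fin m → Fin m → Set
  EdgeOf Es a b = (a , b) ∈ Es ⊎ (b , a) ∈ Es

  EdgeList : List (Fin m × Fin m) → Set
  EdgeList Es = Unique Es × (∀ a b → (a , b) ∈ Es → Adj K a b × (b , a) ∉ Es)

  IsTree : List (Fin m) → List (Fin m × Fin m) → Set
  IsTree Vs Es =
    Unique Vs × 1 ≤ length Vs × EdgeList Es ×
    (∀ a b → (a , b) ∈ Es → a ∈ Vs × b ∈ Vs) ×
    length Es ≡ length Vs ∸ 1 ×
    (∀ u v → u ∈ Vs → v ∈ Vs → Star (EdgeOf Es) u v)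

  BoundaryPath : Fin n → List (Fin m) → Set
  BoundaryPath F P = Unique P × (∀ a b → (a , b) ∈ pairs P → OnBoundary K F a b)

  ProperTree : List (Fin m) → List (Fin m × Fin m) → Set
  ProperTree Vs Es =
    IsTree Vs Es ×
    sum (map (degree K) Vs) ≡ n + 2 * (length Vs ∸ 1) ×
    (∀ F u₁ u₂ → u₁ ∈ Vs → u₂ ∈ Vs → u₁ ∈ face K F → u₂ ∈ face K F →
       ∃ λ P → BoundaryPath F P × head P ≡ just u₁ × last P ≡ just u₂ ×
         All (_∈ Vs) P × (∀ a b → (a , b) ∈ pairs P → EdgeOf Es a b)) ×
    (∀ F P → BoundaryPath F P → (∀ a b → (a , b) ∈ pairs P → EdgeOf Es a b) →
       length P ∸ 1 ≤ length (face K F) ∸ 2)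

  OnB : Fin n → Fin m × Fin m → Set
  OnB F (a , b) = OnBoundary K F a b

  Admissible : List (Fin m × Fin m) → Set
  Admissible E =
    EdgeList E ×
    length E ≡ n ×
    (∀ F → ∃₂ λ e₁ e₂ → e₁ ∈ E × e₂ ∈ E × e₁ ≢ e₂ × OnB F e₁ × OnB F e₂ ×
       (∀ e → e ∈ E → OnB F e → e ≡ e₁ ⊎ e ≡ e₂)) ×
    (∃ λ (Fs : List (Fin n)) → length Fs ≡ n × Unique Fs ×
       (∀ F G → (F , G) ∈ cpairs Fs →
          ∃₂ λ a b → EdgeOf E a b × MeetInEdge K F G a b))

  CompAdj : List (Fin m × Fin m) → Fin m → Fin m → Set
  CompAdj E a b = Adj K a b × ¬ EdgeOf E a b

  ProperTypeII : List (Fin m × Fin m) → Set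
  ProperTypeII E =
    Admissible E ×
    (∃₂ λ x y → ¬ Star (CompAdj E) x y ×
       (∀ z → Star (CompAdj E) x z ⊎ Star (CompAdj E) y z) ×
       (∃₂ λ Vs Es → ProperTree Vs Es ×
          (∀ z → (z ∈ Vs) ⇔ Star (CompAdj E) x z) ×
          (∀ a b → EdgeOf Es a b ⇔ (CompAdj E a b × Star (CompAdj E) x a))))

{-# OPTIONS --safe #-}
module Submission where

-- For a proper tree T let E be the set of edges of K with exactly one end in T.
-- Conditions (2) and (3) make T an induced subgraph meeting every face it touches
-- in a proper arc of the boundary, so such a face has exactly two edges in E.
-- Walking around T (in M: around the disc formed by the faces dual to T) gives a
-- closed walk through faces of K crossing each edge of E once; its length is
-- Σ deg - 2(k-1) = n.  No face is visited twice, as it would then have three edges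
-- in E, so the walk is a Hamiltonian cycle through all n faces.  Consecutive faces of
-- it share a vertex outside T, and outside T each face boundary is connected, hence
-- so is the complement of T.

open import Defs
open import Data.Nat using (ℕ; zero; suc; _+_; _*_; _∸_; _≤_; z≤n; s≤s)
open import Data.Nat.Properties
  using (≤-trans; ≤-reflexive; ≤-refl; +-suc; +-identityʳ; +-monoʳ-≤; <⇒≱; +-cancelʳ-≡)
open import Data.Nat.ListAction using (sum)
open import Data.Nat.ListAction.Properties using (sum-↭)
open import Data.Nat.Solver using (module +-*-Solver)
open import Data.Fin using (Fin)
open import Data.Fin.Properties using () renaming (_≟_ to _≟F_)
open import Data.List
  using (List; []; _∷_; _++_; [_]; _∷ʳ_; length; map; initLast; _∷ʳ′_; head; last; allFin)
open import Data.List.Properties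
  using (++-assoc; ++-identityʳ; ∷ʳ-injectiveʳ; ∷-injectiveˡ; length-map; length-++; length-tabulate)
open import Data.List.Membership.Propositional using (_∈_; _∉_; find)
open import Data.List.Membership.Propositional.Properties
  using (∈-++⁺ˡ; ∈-++⁺ʳ; ∈-++⁻; ∈-∃++; ∈-map⁺; ∈-map⁻; ∈-allFin; ∈-filter⁺; ∈-filter⁻)
open import Data.List.Membership.Propositional.Properties.WithK using (unique∧set⇒bag)
import Data.List.Membership.DecPropositional as DecMem
open import Data.List.Relation.Unary.Any using (here; there)
open import Data.List.Relation.Unary.All as All using (All; []; _∷_)
import Data.List.Relation.Unary.All.Properties as All
open import Data.List.Relation.Unary.AllPairs using ([]; _∷_)
open import Data.List.Relation.Unary.Unique.Propositional using (Unique)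
import Data.List.Relation.Unary.Unique.Propositional.Properties as Unique
open import Data.List.Relation.Binary.BagAndSetEquality using (∼bag⇒↭)
open import Data.List.Relation.Binary.Subset.Propositional using (_⊆_)
open import Data.List.Relation.Binary.Pointwise as PW using (Pointwise; []; _∷_)
open import Data.List.Relation.Binary.Permutation.Propositional
  using (_↭_; ↭-refl; ↭-sym; ↭-trans; ↭-reflexive; prep; ↭⇒↭ₛ)
open import Data.List.Relation.Binary.Permutation.Propositional.Properties
  using (∈-resp-↭; ↭-length; ++-comm; shift; map⁺)
import Data.List.Relation.Binary.Permutation.Setoid.Properties as PermS
open import Data.Maybe using (just)
open import Data.Product using (∃; ∃₂; _×_; _,_; proj₁; proj₂)
open import Data.Product.Properties using (,-injectiveʳ)
open import Data.Sum using (_⊎_; inj₁; inj₂; [_,_]′) renaming (swap to ⊎-swap)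
open import Data.Empty using (⊥; ⊥-elim)
open import Function using (_∘_; id)
open import Function.Bundles using (_⇔_; mk⇔; Equivalence)
open import Relation.Nullary using (Dec; yes; no; ¬_; contradiction)
open import Relation.Nullary.Decidable using (_⊎-dec_)
open import Relation.Binary.Construct.Closure.ReflexiveTransitive as Star
  using (Star; ε; _◅_; _◅◅_; reverse)
open import Relation.Binary.PropositionalEquality
  using (_≡_; _≢_; refl; sym; trans; cong; cong₂; subst; subst₂; setoid; module ≡-Reasoning)

open Equivalence using (to; from)

-- "Walking around the tree" would usually mean following the boundary of a disc neighbourhood. No
-- such topology is available here, so the closed walk is built by induction, attaching the vertices
-- of the tree one at a time as leaves. The subtrees met on the way need not be proper, so the
-- induction cannot speak of edges with exactly one end in the tree. It keeps all darts (oriented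
-- edges) that start in the subtree and are not tree edges, chords appearing in both directions.
-- Only for the full tree, once it is known to be induced, do these darts become the cut. Since the
-- surface may be nonorientable, no rotation sense is fixed globally; the walk around each new leaf
-- is reversed when necessary. Polyhedrality enters through the fact that two faces of `M` share at
-- most one edge, so that an edge of `K` crosses a single edge of `M` and determines its two sides.

private
  variable
    A : Set

-- Lists without repetition

Unique-resp-↭ : {xs ys : List A} → xs ↭ ys → Unique xs → Unique ys
Unique-resp-↭ {A = A} p = PermS.Unique-resp-↭ (setoid A) (↭⇒↭ₛ p)

head∉ : {x : A} {xs : List A} → Unique (x ∷ xs) → x ∉ xs
head∉ = Unique.Unique[x∷xs]⇒x∉xs

∉⇒Unique : {x : A} {xs : List A} → x ∉ xs → Unique xs → Unique (x ∷ xs)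
∉⇒Unique x∉ u = All.tabulate (λ { p refl → x∉ p }) ∷ u

unique-⊆⇒≤ : {xs ys : List A} → Unique xs → xs ⊆ ys → length xs ≤ length ys
unique-⊆⇒≤ {xs = []} _ _ = z≤n
unique-⊆⇒≤ {xs = x ∷ xs} u@(_ ∷ u′) s with ∈-∃++ (s (here refl))
... | as , bs , refl =
  ≤-trans (s≤s (unique-⊆⇒≤ u′ t)) (≤-reflexive (sym (↭-length (shift x as bs))))
  where
  t : xs ⊆ as ++ bs
  t z∈ with ∈-resp-↭ (shift x as bs) (s (there z∈))
  ... | here refl = contradiction z∈ (head∉ u)
  ... | there z∈′ = z∈′

distinct₃⇒3≤ : {x y z : A} {xs : List A} → x ≢ y → x ≢ z → y ≢ z →
  x ∈ xs → y ∈ xs → z ∈ xs → 3 ≤ length xs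
distinct₃⇒3≤ xy xz yz p q r =
  unique-⊆⇒≤ ((xy ∷ xz ∷ []) ∷ (yz ∷ []) ∷ [] ∷ [])
    λ { (here refl) → p ; (there (here refl)) → q ; (there (there (here refl))) → r }

∈-pair : {x y a b c : A} → x ≢ y → a ≢ b → a ≡ x ⊎ a ≡ y → b ≡ x ⊎ b ≡ y →
  c ≡ x ⊎ c ≡ y → c ≡ a ⊎ c ≡ b
∈-pair x≢y a≢b (inj₁ refl) (inj₁ refl) c = ⊥-elim (a≢b refl)
∈-pair x≢y a≢b (inj₁ refl) (inj₂ refl) c = c
∈-pair x≢y a≢b (inj₂ refl) (inj₁ refl) c = ⊎-swap c
∈-pair x≢y a≢b (inj₂ refl) (inj₂ refl) c = ⊥-elim (a≢b refl)

-- Cyclic lists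

pairs⊆ : {u v : A} (xs : List A) → (u , v) ∈ pairs xs → u ∈ xs × v ∈ xs
pairs⊆ (x ∷ y ∷ xs) (here refl) = here refl , there (here refl)
pairs⊆ (x ∷ y ∷ xs) (there p) = let a , b = pairs⊆ (y ∷ xs) p in there a , there b

pairs-++ : (xs : List A) (y : A) (ys : List A) →
  pairs (xs ++ y ∷ ys) ≡ pairs (xs ∷ʳ y) ++ pairs (y ∷ ys)
pairs-++ []            y ys = refl
pairs-++ (x ∷ [])      y ys = refl
pairs-++ (x ∷ x′ ∷ xs) y ys = cong ((x , x′) ∷_) (pairs-++ (x′ ∷ xs) y ys)

pairs-∷ʳ∷ : (xs : List A) (x y : A) (ys : List A) →
  pairs ((xs ∷ʳ x) ++ y ∷ ys) ≡ pairs (xs ∷ʳ x) ++ (x , y) ∷ pairs (y ∷ ys)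
pairs-∷ʳ∷ xs x y ys =
  trans (cong pairs (++-assoc xs [ x ] (y ∷ ys))) (pairs-++ xs x (y ∷ ys))

cpairs⊆ : {u v : A} (xs : List A) → (u , v) ∈ cpairs xs → u ∈ xs × v ∈ xs
cpairs⊆ xs@(x ∷ _) p with pairs⊆ (xs ∷ʳ x) p
... | a , b = back a , back b
  where
  back : ∀ {w} → w ∈ xs ∷ʳ x → w ∈ xs
  back q with ∈-++⁻ xs q
  ... | inj₁ q′ = q′
  ... | inj₂ (here refl) = here refl

map-proj₁-cpairs : (xs : List A) → map proj₁ (cpairs xs) ≡ xs
map-proj₁-cpairs [] = refl
map-proj₁-cpairs (x ∷ xs) = go x xs
  where
  go : ∀ {z : A} y ys → map proj₁ (pairs ((y ∷ ys) ∷ʳ z)) ≡ y ∷ ys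
  go y [] = refl
  go y (y′ ∷ ys) = cong (y ∷_) (go y′ ys)

Unique-cpairs : {xs : List A} → Unique xs → Unique (cpairs xs)
Unique-cpairs {xs = xs} u = Unique.map⁻ (subst Unique (sym (map-proj₁-cpairs xs)) u)

-- c ↻ c′ holds when c′ is a rotation of c; only the invariants are recorded.
_↻_ : List A → List A → Set
c ↻ c′ = c ↭ c′ × cpairs c ↭ cpairs c′

↻-trans : {c c′ c″ : List A} → c ↻ c′ → c′ ↻ c″ → c ↻ c″
↻-trans (p , q) (p′ , q′) = ↭-trans p p′ , ↭-trans q q′

rotate : (xs ys : List A) → (xs ++ ys) ↻ (ys ++ xs)
rotate xs ys = ++-comm xs ys , go xs ys
  where
  go : (xs ys : List A) → cpairs (xs ++ ys) ↭ cpairs (ys ++ xs)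
  go [] ys = ↭-reflexive (cong cpairs (sym (++-identityʳ ys)))
  go (x ∷ xs) [] = ↭-reflexive (cong cpairs (++-identityʳ (x ∷ xs)))
  go (x ∷ xs) (y ∷ ys) = ↭-trans (↭-reflexive (half x xs y ys))
    (↭-trans (++-comm (pairs ((x ∷ xs) ∷ʳ y)) (pairs ((y ∷ ys) ∷ʳ x)))
      (↭-reflexive (sym (half y ys x xs))))
    where
    half : ∀ x xs y ys → cpairs ((x ∷ xs) ++ y ∷ ys)
      ≡ pairs ((x ∷ xs) ∷ʳ y) ++ pairs ((y ∷ ys) ∷ʳ x)
    half x xs y ys = trans (cong pairs (++-assoc (x ∷ xs) (y ∷ ys) [ x ]))
      (pairs-++ (x ∷ xs) y (ys ∷ʳ x))

rotate-to : {x : A} {c : List A} → x ∈ c → ∃ λ c′ → c ↻ (x ∷ c′)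
rotate-to x∈ with ∈-∃++ x∈
... | as , bs , refl = bs ++ as , rotate as (_ ∷ bs)

record Neighbours {A : Set} (c : List A) (j : A) : Set where
  field
    pred succ : A
    pred≢succ : pred ≢ succ
    pred∈     : (pred , j) ∈ cpairs c
    succ∈     : (j , succ) ∈ cpairs c
    pred!     : ∀ {x} → (x , j) ∈ cpairs c → x ≡ pred
    succ!     : ∀ {x} → (j , x) ∈ cpairs c → x ≡ succ

open Neighbours

-- Rotated to begin at `j`, the cycle reads `j`, `s`, ..., `r`. At least three entries put `s` and
-- `r` in different positions, hence `pred≢succ`.
neighbours : {c : List A} → Unique c → 3 ≤ length c → ∀ {j} → j ∈ c → Neighbours c j
neighbours u 3≤ {j} j∈ with rotate-to j∈
... | l , p , q with ≤-trans 3≤ (≤-reflexive (↭-length p)) | Unique-resp-↭ p u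
neighbours {c = c} u 3≤ {j} j∈ | s ∷ l , p , q | s≤s (s≤s 1≤) | u′ with initLast l
neighbours {c = c} u 3≤ {j} j∈ | s ∷ .(m ∷ʳ r) , p , q | s≤s (s≤s 1≤) | u′@(_ ∷ u″) | m ∷ʳ′ r = record
  { pred = r ; succ = s
  ; pred≢succ = λ { refl → head∉ u″ (∈-++⁺ʳ m (here refl)) }
  ; pred∈ = fold (there (∈-++⁺ʳ (pairs sm) (here refl)))
  ; succ∈ = fold (here refl)
  ; pred! = λ e → case₁ (unfold e)
  ; succ! = λ e → case₂ (unfold e)
  }
  where
  sm = s ∷ (m ∷ʳ r)
  eq : cpairs (j ∷ sm) ≡ (j , s) ∷ pairs sm ++ [ (r , j) ]
  eq = cong ((j , s) ∷_) (pairs-∷ʳ∷ (s ∷ m) r j [])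
  fold : ∀ {e} → e ∈ (j , s) ∷ pairs sm ++ [ (r , j) ] → e ∈ cpairs c
  fold {e} = ∈-resp-↭ (↭-sym q) ∘ subst (e ∈_) (sym eq)
  unfold : ∀ {e} → e ∈ cpairs c → e ∈ (j , s) ∷ pairs sm ++ [ (r , j) ]
  unfold {e} = subst (e ∈_) eq ∘ ∈-resp-↭ q
  r∈ : r ∈ sm
  r∈ = there (∈-++⁺ʳ m (here refl))
  case₁ : ∀ {x} → (x , j) ∈ (j , s) ∷ pairs sm ++ [ (r , j) ] → x ≡ r
  case₁ (here refl) = contradiction (here refl) (head∉ u′)
  case₁ (there e) with ∈-++⁻ (pairs sm) e
  ... | inj₁ e′ = contradiction (proj₂ (pairs⊆ sm e′)) (head∉ u′)
  ... | inj₂ (here refl) = refl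
  case₂ : ∀ {x} → (j , x) ∈ (j , s) ∷ pairs sm ++ [ (r , j) ] → x ≡ s
  case₂ (here refl) = refl
  case₂ (there e) with ∈-++⁻ (pairs sm) e
  ... | inj₁ e′ = contradiction (proj₁ (pairs⊆ sm e′)) (head∉ u′)
  ... | inj₂ (here refl) = contradiction r∈ (head∉ u′)

-- Walks

-- The labels form an index, so that cutting, rotating and permuting a list of darts can be followed
-- by the same operation on the walk.
data Walk {V D : Set} (L : V → D → V → Set) : V → List D → V → Set where
  []  : ∀ {v} → Walk L v [] v
  _∷_ : ∀ {u v w d ds} → L u d v → Walk L v ds w → Walk L u (d ∷ ds) w

module _ {V D : Set} {L : V → D → V → Set} where

  starts : ∀ {u ds v} → Walk L u ds v → List V
  starts [] = []
  starts (_∷_ {u = u} _ w) = u ∷ starts w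

  length-starts : ∀ {u ds v} (w : Walk L u ds v) → length (starts w) ≡ length ds
  length-starts [] = refl
  length-starts (_ ∷ w) = cong suc (length-starts w)

  infixr 5 _++ʷ_

  _++ʷ_ : ∀ {u v w ds es} → Walk L u ds v → Walk L v es w → Walk L u (ds ++ es) w
  [] ++ʷ q = q
  (l ∷ p) ++ʷ q = l ∷ (p ++ʷ q)

  split : ∀ ds {es u w} → Walk L u (ds ++ es) w → ∃ λ v → Walk L u ds v × Walk L v es w
  split [] p = _ , [] , p
  split (d ∷ ds) (l ∷ p) = let v , q , r = split ds p in v , l ∷ q , r

  mapʷ : ∀ {E : Set} {L′ : V → E → V → Set} {f : D → E} → (∀ {u d v} → L u d v → L′ u (f d) v) →
    ∀ {u ds v} → Walk L u ds v → Walk L′ u (map f ds) v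
  mapʷ g [] = []
  mapʷ g (l ∷ p) = g l ∷ mapʷ g p

  reverseʷ : (∀ {u d v} → L u d v → L v d u) → ∀ {u ds v} → Walk L u ds v →
    ∃ λ es → es ↭ ds × Walk L v es u
  reverseʷ s [] = [] , ↭-refl , []
  reverseʷ s (_∷_ {d = d} {ds} l p) with reverseʷ s p
  ... | es , e , q = es ∷ʳ d , ↭-trans (++-comm es [ d ]) (prep d e) , q ++ʷ (s l ∷ [])

choose : {A B : Set} {P : A → B → Set} {xs : List A} → (∀ {x} → x ∈ xs → ∃ (P x)) →
  ∃ (Pointwise P xs)
choose {xs = []} f = [] , []
choose {xs = x ∷ xs} f with f (here refl) | choose (f ∘ there)
... | y , p | ys , ps = y ∷ ys , p ∷ ps

module _ {A B : Set} {P : A → B → Set} where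

  pw-∈ˡ : ∀ {xs ys} → Pointwise P xs ys → ∀ {x} → x ∈ xs → ∃ λ y → y ∈ ys × P x y
  pw-∈ˡ (p ∷ ps) (here refl) = _ , here refl , p
  pw-∈ˡ (p ∷ ps) (there i) = let y , j , q = pw-∈ˡ ps i in y , there j , q

  pw-∈ʳ : ∀ {xs ys} → Pointwise P xs ys → ∀ {y} → y ∈ ys → ∃ λ x → x ∈ xs × P x y
  pw-∈ʳ (p ∷ ps) (here refl) = _ , here refl , p
  pw-∈ʳ (p ∷ ps) (there i) = let x , j , q = pw-∈ʳ ps i in x , there j , q

  pw-unique : ∀ {xs ys} → Pointwise P xs ys → Unique xs →
    (∀ {x x′ y} → x ∈ xs → x′ ∈ xs → P x y → P x′ y → x ≡ x′) → Unique ys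
  pw-unique [] _ _ = []
  pw-unique (p ∷ ps) u@(_ ∷ u′) inj =
    ∉⇒Unique (λ y∈ → let x , x∈ , q = pw-∈ʳ ps y∈ in
        head∉ u (subst (_∈ _) (inj (there x∈) (here refl) q p) x∈))
      (pw-unique ps u′ (λ i j → inj (there i) (there j)))

walk-pairs : {V D : Set} {L : V → D → V → Set} (v : V) (vs : List V) (z : V) {ds : List D} →
  Pointwise (λ e d → L (proj₁ e) d (proj₂ e)) (pairs ((v ∷ vs) ∷ʳ z)) ds → Walk L v ds z
walk-pairs v [] z (l ∷ []) = l ∷ []
walk-pairs v (v′ ∷ vs) z (l ∷ ls) = l ∷ walk-pairs v′ vs z ls

-- Polygonal faces

module _ {nv nf : ℕ} (M : Map nv nf) where

  ∂-sym : ∀ {f u v} → OnBoundary M f u v → OnBoundary M f v u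
  ∂-sym = ⊎-swap

  ∂⊆ : ∀ {f u v} → OnBoundary M f u v → u ∈ face M f × v ∈ face M f
  ∂⊆ {f} (inj₁ e) = cpairs⊆ (face M f) e
  ∂⊆ {f} (inj₂ e) = let p , q = cpairs⊆ (face M f) e in q , p

  -- Stated apart from `IsMap` so that it can also be proved for `K`, as `K-polygonal`.
  Polygonal : Set
  Polygonal = ∀ f → 3 ≤ length (face M f) × Unique (face M f)

  module _ (poly : Polygonal) where

    abstract
      nbrs : ∀ {f j} → j ∈ face M f → Neighbours (face M f) j
      nbrs {f} = neighbours (proj₂ (poly f)) (proj₁ (poly f))

    ∂-nbrs : ∀ {f j} (i : j ∈ face M f) {x} → OnBoundary M f j x →
      x ≡ pred (nbrs i) ⊎ x ≡ succ (nbrs i)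
    ∂-nbrs i (inj₁ e) = inj₂ (succ! (nbrs i) e)
    ∂-nbrs i (inj₂ e) = inj₁ (pred! (nbrs i) e)

    ∂-irrefl : ∀ {f u} → ¬ OnBoundary M f u u
    ∂-irrefl b with nbrs (proj₁ (∂⊆ b))
    ... | nb = pred≢succ nb (trans (sym (pred! nb e)) (succ! nb e))
      where e = [ id , id ]′ b

    ∂-≢ : ∀ {f u v} → OnBoundary M f u v → u ≢ v
    ∂-≢ b refl = ∂-irrefl b

    oriented : ∀ {f u v} → (u , v) ∈ cpairs (face M f) → (v , u) ∉ cpairs (face M f)
    oriented {f} e e′ = pred≢succ nb (trans (sym (pred! nb e′)) (succ! nb e))
      where nb = nbrs (proj₁ (cpairs⊆ (face M f) e))

-- One step of a walk through faces: crossing an edge from `F` to `G`. The order of `a` and `b`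
-- carries extra information, namely which end belongs to the tree.
Link : {nv nf : ℕ} (K : Map nv nf) → Fin nf → Fin nv × Fin nv → Fin nf → Set
Link K F (a , b) G = F ≢ G × OnBoundary K F a b × OnBoundary K G a b

Link-sym : ∀ {nv nf} (K : Map nv nf) {F e G} → Link K F e G → Link K G e F
Link-sym K (F≢G , p , q) = F≢G ∘ sym , q , p

-- Edges and vertex stars of the dual map

module Dual {n nf : ℕ} (M : Map n nf) (K : Map nf n)
  (isMap : IsMap M) (polyhedral : Polyhedral M) (dual : IsDual M K) where

  private
    M-polygonal = proj₁ isMap
    M-edges = proj₁ (proj₂ isMap)
    M-links = proj₁ (proj₂ (proj₂ isMap))

  ∈-dual : ∀ {j f} → f ∈ face K j → j ∈ face M f
  ∈-dual = to (proj₁ (proj₂ dual) _ _)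

  ∈-dual⁻ : ∀ {j f} → j ∈ face M f → f ∈ face K j
  ∈-dual⁻ = from (proj₁ (proj₂ dual) _ _)

  K-∂⇒M-edge : ∀ {j f g} → OnBoundary K j f g → ∃ λ u → OnBoundary M f j u × OnBoundary M g j u
  K-∂⇒M-edge (inj₁ e) = proj₁ (proj₂ (proj₂ dual)) _ _ _ e
  K-∂⇒M-edge (inj₂ e) = let u , p , q = proj₁ (proj₂ (proj₂ dual)) _ _ _ e in u , q , p

  K-adj : ∀ {f g} → Adj K f g ⇔ (f ≢ g × ∃₂ λ u v → OnBoundary M f u v × OnBoundary M g u v)
  K-adj = proj₂ (proj₂ (proj₂ dual)) _ _

  other-face : ∀ {f u v} → OnBoundary M f u v → ∃ λ g → g ≢ f × OnBoundary M g u v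
  other-face {f} b with M-edges _ _ (f , b)
  ... | g , h , g≢h , bg , bh , only with g ≟F f
  ... | yes refl = h , g≢h ∘ sym , bh
  ... | no g≢f = g , g≢f , bg

  edge-faces : ∀ {f g h u v} → f ≢ g → OnBoundary M f u v → OnBoundary M g u v →
    OnBoundary M h u v → h ≡ f ⊎ h ≡ g
  edge-faces f≢g bf bg bh with M-edges _ _ (_ , bf)
  ... | x , y , x≢y , _ , _ , only = ∈-pair x≢y f≢g (only _ bf) (only _ bg) (only _ bh)

  -- Among the three cases of polyhedrality, two distinct common vertices leave only the shared
  -- edge, and they must be its two ends.
  common-edge : ∀ {f g u v} → f ≢ g → u ≢ v → u ∈ face M f → u ∈ face M g →
    v ∈ face M f → v ∈ face M g → MeetInEdge M f g u v
  common-edge {f} {g} f≢g u≢v uf ug vf vg with polyhedral f g f≢g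
  ... | inj₁ none = ⊥-elim (none _ uf ug)
  ... | inj₂ (inj₁ (x , one)) = contradiction (trans (one _ uf ug) (sym (one _ vf vg))) u≢v
  ... | inj₂ (inj₂ (a , b , af , ag , two)) = resp af , resp ag ,
      λ w wf wg → ∈-pair (∂-≢ M M-polygonal af) u≢v (two _ uf ug) (two _ vf vg) (two _ wf wg)
    where
    resp : ∀ {h} → OnBoundary M h a b → OnBoundary M h _ _
    resp h with two _ uf ug | two _ vf vg
    ... | inj₁ refl | inj₁ refl = ⊥-elim (u≢v refl)
    ... | inj₁ refl | inj₂ refl = h
    ... | inj₂ refl | inj₁ refl = ∂-sym M h
    ... | inj₂ refl | inj₂ refl = ⊥-elim (u≢v refl)

  abstract
    -- Three faces of `M` at `j` are some `f` and the faces across its two edges at `j`. The latter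
    -- differ, since otherwise one face would share three vertices with `f`.
    K-polygonal : Polygonal K
    K-polygonal j = 3≤ , proj₁ dual j
      where
      a-face : ∃ λ f → j ∈ face M f
      a-face with M-links j
      ... | (f ∷ _) , _ , _ , iff , _ = f , to (iff f) (here refl)
      3≤ : 3 ≤ length (face K j)
      3≤ with a-face
      ... | f , j∈f with nbrs M M-polygonal j∈f
      ... | nb with other-face {f} (inj₂ (pred∈ nb)) | other-face {f} (inj₁ (succ∈ nb))
      ... | g , g≢f , bg | h , h≢f , bh =
        distinct₃⇒3≤ (g≢f ∘ sym) (h≢f ∘ sym) g≢h (∈-dual⁻ j∈f)
          (∈-dual⁻ (proj₁ (∂⊆ M bg))) (∈-dual⁻ (proj₁ (∂⊆ M bh)))
        where
        bs : OnBoundary M f j (succ nb)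
        bs = inj₁ (succ∈ nb)
        bp : OnBoundary M f j (pred nb)
        bp = inj₂ (pred∈ nb)
        g≢h : g ≢ h
        g≢h refl with common-edge (g≢f ∘ sym) (∂-≢ M M-polygonal bs) (proj₁ (∂⊆ M bs))
                      (proj₁ (∂⊆ M bh)) (proj₂ (∂⊆ M bs)) (proj₂ (∂⊆ M bh))
        ... | _ , _ , two with two _ (proj₂ (∂⊆ M bp)) (proj₂ (∂⊆ M bg))
        ... | inj₁ eq = ∂-≢ M M-polygonal bp (sym eq)
        ... | inj₂ eq = pred≢succ nb eq

  -- Both edges of f at j are shared with the two neighbours of f in the cyclic
  -- list face K j, so every face sharing an edge at j with f is such a neighbour.
  M-edge⇒K-∂ : ∀ {j u f g} → f ≢ g → OnBoundary M f j u → OnBoundary M g j u → OnBoundary K j f g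
  M-edge⇒K-∂ {j} {u} {f} {g} f≢g bf bg = finish
    where
    kn = nbrs K K-polygonal (∈-dual⁻ (proj₁ (∂⊆ M bf)))
    p = pred kn
    s = succ kn
    Kp : OnBoundary K j f p
    Kp = inj₂ (pred∈ kn)
    Ks : OnBoundary K j f s
    Ks = inj₁ (succ∈ kn)
    x≢y : ∀ {x y} → OnBoundary M f j x → OnBoundary M p j x → OnBoundary M s j y → x ≢ y
    x≢y fx px sy refl = [ ∂-≢ K K-polygonal Ks ∘ sym , pred≢succ kn ∘ sym ]′
      (edge-faces (∂-≢ K K-polygonal Kp) fx px sy)
    via : ∀ {h x} → OnBoundary K j f h → OnBoundary M f j x → OnBoundary M h j x → u ≡ x →
      OnBoundary K j f g
    via Kh fu hu refl with edge-faces (∂-≢ K K-polygonal Kh) fu hu bg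
    ... | inj₁ eq = ⊥-elim (f≢g (sym eq))
    ... | inj₂ refl = Kh
    j∈ : j ∈ face M f
    j∈ = proj₁ (∂⊆ M bf)
    finish : OnBoundary K j f g
    finish =
      let x , fx , px = K-∂⇒M-edge Kp
          y , fy , sy = K-∂⇒M-edge Ks
          nb = nbrs M M-polygonal j∈
      in [ via Kp fx px , via Ks fy sy ]′
           (∈-pair (pred≢succ nb) (x≢y fx px sy)
             (∂-nbrs M M-polygonal j∈ fx) (∂-nbrs M M-polygonal j∈ fy) (∂-nbrs M M-polygonal j∈ bf))

  -- In `M`, the vertices `F`, `G` and `H` all lie on both faces `a` and `b`, and these meet only in
  -- the edge from `F` to `G`.
  link-faces : ∀ {F G H a b} → Link K F (a , b) G → OnBoundary K H a b → H ≡ F ⊎ H ≡ G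
  link-faces (F≢G , p , q) r
    with common-edge (∂-≢ K K-polygonal p) F≢G
           (∈-dual (proj₁ (∂⊆ K p))) (∈-dual (proj₂ (∂⊆ K p)))
           (∈-dual (proj₁ (∂⊆ K q))) (∈-dual (proj₂ (∂⊆ K q)))
  ... | _ , _ , two = two _ (∈-dual (proj₁ (∂⊆ K r))) (∈-dual (proj₂ (∂⊆ K r)))

  -- A further common vertex of `F` and `G` in `K` would be a third face of `M` containing the edge
  -- from `F` to `G`.
  link-meet : ∀ {F G a b} → Link K F (a , b) G → MeetInEdge K F G a b
  link-meet {a = a} (F≢G , p , q)
    with common-edge (∂-≢ K K-polygonal p) F≢G
           (∈-dual (proj₁ (∂⊆ K p))) (∈-dual (proj₂ (∂⊆ K p)))
           (∈-dual (proj₁ (∂⊆ K q))) (∈-dual (proj₂ (∂⊆ K q)))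
  ... | aFG , bFG , _ = p , q , only
    where
    only : ∀ w → _ → _ → _
    only w wF wG with w ≟F a
    ... | yes w≡a = inj₁ w≡a
    ... | no w≢a with common-edge w≢a F≢G (∈-dual wF) (∈-dual (proj₁ (∂⊆ K p)))
                        (∈-dual wG) (∈-dual (proj₁ (∂⊆ K q)))
    ... | wFG , _ , _ = edge-faces (∂-≢ K K-polygonal p) aFG bFG wFG

  -- `o` is the face of `M` on the other side of the edge `e` of `b`. In `K` the ends of `e` are the
  -- two faces separated by the edge from `b` to `o`.
  record Across (b : Fin nf) (e : Fin n × Fin n) (o : Fin nf) : Set where
    field
      link  : Link K (proj₁ e) (b , o) (proj₂ e)
      o≢b   : o ≢ b
      on-o  : OnBoundary M o (proj₁ e) (proj₂ e)
  open Across

  across : ∀ b {e} → e ∈ cpairs (face M b) → ∃ (Across b e)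
  across b i = let o , o≢b , p = other-face {b} (inj₁ i) in o , record
    { link = ∂-≢ M M-polygonal {b} (inj₁ i) , M-edge⇒K-∂ (o≢b ∘ sym) (inj₁ i) p ,
        M-edge⇒K-∂ (o≢b ∘ sym) (inj₂ i) (∂-sym M p)
    ; o≢b = o≢b
    ; on-o = p }

  -- If `o` lies across both edges, `link-faces` gives them the same two ends, and a face boundary
  -- never traverses one pair of vertices in both directions.
  across-injective : ∀ {b e e′ o} → e ∈ cpairs (face M b) → e′ ∈ cpairs (face M b) →
    Across b e o → Across b e′ o → e ≡ e′
  across-injective {b} i i′ x x′ with link x′
  ... | e₁≢e₂ , p , q with link-faces (link x) p | link-faces (link x) q
  ... | inj₁ refl | inj₂ refl = refl
  ... | inj₁ refl | inj₁ refl = ⊥-elim (e₁≢e₂ refl)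
  ... | inj₂ refl | inj₂ refl = ⊥-elim (e₁≢e₂ refl)
  ... | inj₂ refl | inj₁ refl = ⊥-elim (oriented M M-polygonal {b} i i′)

  across-adj : ∀ {b os} → Pointwise (Across b) (cpairs (face M b)) os → ∀ {o} → o ∈ os ⇔ Adj K b o
  across-adj {b} {os} pw = mk⇔ fwd bwd
    where
    fwd : ∀ {o} → o ∈ os → Adj K b o
    fwd i with pw-∈ʳ pw i
    ... | _ , _ , x = _ , proj₁ (proj₂ (link x))
    go : ∀ {o x y} → b ≢ o → (x , y) ∈ cpairs (face M b) → OnBoundary M o x y → o ∈ os
    go b≢o i oxy with pw-∈ˡ pw i
    ... | o′ , o′∈ , x with edge-faces {b} (o≢b x ∘ sym) (inj₁ i) (on-o x) oxy
    ... | inj₁ eq = ⊥-elim (b≢o (sym eq))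
    ... | inj₂ refl = o′∈
    bwd : ∀ {o} → Adj K b o → o ∈ os
    bwd a with to K-adj a
    ... | b≢o , x , y , inj₁ i , ox = go b≢o i ox
    ... | b≢o , x , y , inj₂ i , ox = go b≢o i (∂-sym M ox)

  across-walk : ∀ {b os} (c : List (Fin n)) → 3 ≤ length c → Pointwise (Across b) (cpairs c) os →
    ∃ λ F → Walk (λ G o → Link K G (b , o)) F os F
  across-walk (F ∷ c) _ pw = F , walk-pairs F c F (PW.map link pw)

  -- The vertices on the boundary of the face `b` of `M`, in cyclic order, are the faces of `K`
  -- around the vertex `b`; each side of the boundary is a crossing of one edge at `b`.
  star : ∀ b → ∃₂ λ F os → Walk (λ G o → Link K G (b , o)) F os F × Unique os ×
    (∀ {o} → o ∈ os ⇔ Adj K b o)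
  star b =
    let os , pw = choose (across b)
        F , w = across-walk (face M b) (proj₁ (M-polygonal b)) pw
    in F , os , w ,
       pw-unique pw (Unique-cpairs (proj₂ (M-polygonal b))) across-injective , across-adj pw

  -- The closed walk around `b` is cut open where it crosses the edge to `a`, which leaves a walk
  -- between the two sides of that edge. By `link-faces` these sides are `F` and `G`, but possibly
  -- in the wrong order: the face lists are not coherently oriented. In that case the walk is
  -- reversed.
  open-star : ∀ {F G a b} → Adj K b a → Link K F (a , b) G →
    ∃ λ os → Walk (Link K) F (map (b ,_) os) G × Unique (a ∷ os) × (∀ {o} → o ∈ a ∷ os ⇔ Adj K b o)
  open-star {F} {G} {a} {b} adj link with star b
  ... | S , os , w , u , iff with ∈-∃++ (from iff adj)
  ... | xs , ys , refl with split xs w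
  ... | I , w₁ , _∷_ {v = J} l@(I≢J , p , q) w₂ = orient (link-faces link (∂-sym K p)) (link-faces link (∂-sym K q))
    where
    perm : xs ++ a ∷ ys ↭ a ∷ ys ++ xs
    perm = ↭-trans (shift a xs ys) (prep a (++-comm xs ys))
    open-walk : Walk (Link K) J (map (b ,_) (ys ++ xs)) I
    open-walk = mapʷ id (w₂ ++ʷ w₁)
    Goal : Set
    Goal = ∃ λ os → Walk (Link K) F (map (b ,_) os) G × Unique (a ∷ os) × (∀ {o} → o ∈ a ∷ os ⇔ Adj K b o)
    pack : ∀ os → os ↭ ys ++ xs → Walk (Link K) F (map (b ,_) os) G → Goal
    pack os e w = os , w , Unique-resp-↭ perm′ u ,
        mk⇔ (to iff ∘ ∈-resp-↭ (↭-sym perm′)) (∈-resp-↭ perm′ ∘ from iff)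
      where
      perm′ : xs ++ a ∷ ys ↭ a ∷ os
      perm′ = ↭-trans perm (prep a (↭-sym e))
    orient : I ≡ F ⊎ I ≡ G → J ≡ F ⊎ J ≡ G → Goal
    orient (inj₁ refl) (inj₁ refl) = ⊥-elim (I≢J refl)
    orient (inj₂ refl) (inj₂ refl) = ⊥-elim (I≢J refl)
    orient (inj₂ refl) (inj₁ refl) = pack (ys ++ xs) ↭-refl open-walk
    orient (inj₁ refl) (inj₂ refl)
      with reverseʷ (λ {F} {o} → Link-sym K {F} {b , o}) (w₂ ++ʷ w₁)
    ... | es , e , w′ = pack es e (mapʷ id w′)

-- Arcs of a cycle

head∈ : {x : A} (xs : List A) → head xs ≡ just x → x ∈ xs
head∈ (x ∷ _) refl = here refl

last∈ : {x : A} (xs : List A) → last xs ≡ just x → x ∈ xs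
last∈ (x ∷ []) refl = here refl
last∈ (_ ∷ y ∷ xs) e = there (last∈ (y ∷ xs) e)

unique-disjoint : {z : A} (xs : List A) {ys : List A} → Unique (xs ++ ys) → z ∈ xs → z ∉ ys
unique-disjoint (x ∷ xs) u (here refl) z∈ = head∉ u (∈-++⁺ʳ xs z∈)
unique-disjoint (x ∷ xs) (_ ∷ u) (there i) z∈ = unique-disjoint xs u i z∈

Unique-++ˡ : (xs : List A) {ys : List A} → Unique (xs ++ ys) → Unique xs
Unique-++ˡ [] u = []
Unique-++ˡ (x ∷ xs) u@(_ ∷ u′) = ∉⇒Unique (head∉ u ∘ ∈-++⁺ˡ) (Unique-++ˡ xs u′)

path-preserves : {S : A → Set} (P : List A) {u v : A} → head P ≡ just u → last P ≡ just v →
  (∀ {x y} → (x , y) ∈ pairs P → S x → S y) → S u → S v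
path-preserves (_ ∷ []) refl refl step s = s
path-preserves (x ∷ y ∷ P) refl e step s =
  path-preserves (y ∷ P) refl e (step ∘ there) (step (here refl) s)

star-along : {R : A → A → Set} → (∀ {x y} → R x y → R y x) → (xs : List A) →
  (∀ {x y} → (x , y) ∈ pairs xs → R x y) → ∀ {u v} → u ∈ xs → v ∈ xs → Star R u v
star-along {A = A} {R} R-sym (x ∷ xs) step i j = reverse R-sym (go x xs step i) ◅◅ go x xs step j
  where
  go : ∀ x xs → (∀ {y z} → (y , z) ∈ pairs (x ∷ xs) → R y z) → ∀ {v} → v ∈ x ∷ xs → Star R x v
  go x xs step (here refl) = ε
  go x (y ∷ ys) step (there j) = step (here refl) ◅ go y ys (step ∘ there) j

∷≡∷ʳ-unique : {x : A} {xs ys : List A} → Unique (x ∷ xs) → x ∷ xs ≡ ys ∷ʳ x → xs ≡ []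
∷≡∷ʳ-unique {ys = []} u refl = refl
∷≡∷ʳ-unique {ys = y ∷ ys} u refl = contradiction (∈-++⁺ʳ ys (here refl)) (head∉ u)

∷ʳ≡++∷ : {a w : A} (m X : List A) {Y : List A} → m ∷ʳ a ≡ X ++ w ∷ Y → w ≡ a ⊎ a ∈ Y
∷ʳ≡++∷ {a = a} {w} m X {Y} eq with initLast Y
... | [] = inj₁ (sym (∷ʳ-injectiveʳ m X eq))
... | Y′ ∷ʳ′ y = inj₂ (subst (_∈ Y) (sym (∷ʳ-injectiveʳ m (X ++ w ∷ Y′)
  (trans eq (sym (++-assoc X (w ∷ Y′) [ y ]))))) (∈-++⁺ʳ Y′ (here refl)))

Side : List A → A → A → Set
Side c u v = (u , v) ∈ cpairs c ⊎ (v , u) ∈ cpairs c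

Side-resp-↻ : {c c′ : List A} → c ↻ c′ → ∀ {u v} → Side c u v → Side c′ u v
Side-resp-↻ (_ , q) (inj₁ e) = inj₁ (∈-resp-↭ q e)
Side-resp-↻ (_ , q) (inj₂ e) = inj₂ (∈-resp-↭ q e)

↻-sym : {c c′ : List A} → c ↻ c′ → c′ ↻ c
↻-sym (p , q) = ↭-sym p , ↭-sym q

module _ {n : ℕ} where

  private
    _∈?_ = DecMem._∈?_ (_≟F_ {n})

  -- Such a path has to run the whole way round, since it cannot jump over a vertex of c.
  long-way-round : {c : List (Fin n)} → Unique c → 3 ≤ length c → ∀ {a b} → (a , b) ∈ cpairs c →
    (P : List (Fin n)) → head P ≡ just a → last P ≡ just b →
    (∀ {x y} → (x , y) ∈ pairs P → Side c x y) →
    (∀ {x y} → (x , y) ∈ pairs P → (x , y) ≢ (a , b) × (x , y) ≢ (b , a)) →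
    length c ≤ length P
  long-way-round {c} u 3≤ {a} {b} ab∈ P hd lst side avoid =
    unique-⊆⇒≤ u λ {w} w∈ → visit w (∈-resp-↭ (proj₁ rot) w∈) (w ∈? P)
    where
    sp = ∈-∃++ (proj₁ (cpairs⊆ c ab∈))
    as = proj₁ sp
    bs = proj₁ (proj₂ sp)
    m = bs ++ as
    eq : bs ++ (as ∷ʳ a) ≡ m ∷ʳ a
    eq = sym (++-assoc bs as [ a ])
    rot : c ↻ (m ∷ʳ a)
    rot = subst₂ _↻_ (trans (++-assoc as [ a ] bs) (sym (proj₂ (proj₂ sp)))) eq (rotate (as ∷ʳ a) bs)
    u′ : Unique (m ∷ʳ a)
    u′ = Unique-resp-↭ (proj₁ rot) u
    split-m : ∀ m → c ↻ (m ∷ʳ a) → ∃ λ m′ → m ≡ b ∷ m′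
    split-m [] r with ≤-trans 3≤ (≤-reflexive (↭-length (proj₁ r)))
    ... | s≤s ()
    split-m (h ∷ m′) r = m′ , cong (_∷ m′) (trans (succ! nb ah) (sym (succ! nb ab∈)))
      where
      nb = neighbours u 3≤ (proj₁ (cpairs⊆ c ab∈))
      ah : (a , h) ∈ cpairs c
      ah = ∈-resp-↭ (↭-sym (proj₂ r)) (subst (_ ∈_) (sym (pairs-∷ʳ∷ (h ∷ m′) a h []))
             (∈-++⁺ʳ (pairs ((h ∷ m′) ∷ʳ a)) (here refl)))
    visit : ∀ w → w ∈ m ∷ʳ a → Dec (w ∈ P) → w ∈ P
    visit w w∈ (yes w∈P) = w∈P
    visit w w∈ (no w∉P) with split-m m rot | ∈-∃++ w∈
    ... | m′ , m≡ | X , Y , eq′ = ⊥-elim (bad X Y eq′)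
      where
      -- Opened at the side from `a` to `b`, the cycle is a list from `b` to `a`, and a missed `w`
      -- separates it into `X` and `Y`. The path starts at `a` in `Y` and no step leaves `Y`, so `b`
      -- would lie in `Y` as well as at the head of `X`.
      bad : ∀ X Y → m ∷ʳ a ≡ X ++ w ∷ Y → ⊥
      bad X Y eq′ with ∷ʳ≡++∷ m X eq′
      bad X Y eq′ | inj₁ refl = w∉P (head∈ P hd)
      bad [] Y eq′ | inj₂ a∈Y =
        w∉P (subst (_∈ P) (∷-injectiveˡ (trans (sym (cong (_∷ʳ a) m≡)) eq′)) (last∈ P lst))
      bad X@(x ∷ X′) Y eq′ | inj₂ a∈Y = unique-disjoint X uX b∈X (there b∈Y)
        where
        uX : Unique (X ++ w ∷ Y)
        uX = subst Unique eq′ u′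
        uX′ : Unique ((X ∷ʳ w) ++ Y)
        uX′ = subst Unique (sym (++-assoc X [ w ] Y)) uX
        b∈X : b ∈ X
        b∈X = here (∷-injectiveˡ (trans (sym (cong (_∷ʳ a) m≡)) eq′))
        cp : ∀ {e} → e ∈ cpairs c → e ∈ pairs (X ∷ʳ w) ⊎ e ∈ pairs (w ∷ Y) ⊎ e ≡ (a , b)
        cp {e} i with ∈-++⁻ (pairs (m ∷ʳ a)) (subst (e ∈_) cpairs-m (∈-resp-↭ (proj₂ rot) i))
          where
          cpairs-m : cpairs (m ∷ʳ a) ≡ pairs (m ∷ʳ a) ++ [ (a , b) ]
          cpairs-m rewrite m≡ = pairs-∷ʳ∷ (b ∷ m′) a b []
        ... | inj₂ (here e≡) = inj₂ (inj₂ e≡)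
        ... | inj₁ j with ∈-++⁻ (pairs (X ∷ʳ w))
                            (subst (e ∈_) (trans (cong pairs eq′) (pairs-++ X w Y)) j)
        ...   | inj₁ k = inj₁ k
        ...   | inj₂ k = inj₂ (inj₁ k)
        tail-∈ : ∀ {z} → z ∈ w ∷ Y → z ∈ P → z ∈ Y
        tail-∈ (here refl) z∈P = ⊥-elim (w∉P z∈P)
        tail-∈ (there i) _ = i
        step : ∀ {x y} → (x , y) ∈ pairs P → x ∈ Y → y ∈ Y
        step i x∈Y with side i
        ... | inj₁ e with cp e
        ...   | inj₁ k = ⊥-elim (unique-disjoint (X ∷ʳ w) uX′ (proj₁ (pairs⊆ (X ∷ʳ w) k)) x∈Y)
        ...   | inj₂ (inj₁ k) = tail-∈ (proj₂ (pairs⊆ (w ∷ Y) k)) (proj₂ (pairs⊆ P i))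
        ...   | inj₂ (inj₂ refl) = ⊥-elim (proj₁ (avoid i) refl)
        step i x∈Y | inj₂ e with cp e
        ...   | inj₁ k = ⊥-elim (unique-disjoint (X ∷ʳ w) uX′ (proj₂ (pairs⊆ (X ∷ʳ w) k)) x∈Y)
        ...   | inj₂ (inj₁ k) = tail-∈ (proj₁ (pairs⊆ (w ∷ Y) k)) (proj₂ (pairs⊆ P i))
        ...   | inj₂ (inj₂ refl) = ⊥-elim (proj₂ (avoid i) refl)
        b∈Y : b ∈ Y
        b∈Y = path-preserves {S = _∈ Y} P hd lst step a∈Y

module _ {A : Set} (T : A → Set) (T? : ∀ x → Dec (T x)) where

  -- Records what is used of the fact that `T` cuts the cycle in a nonempty proper arc. The two
  -- crossing sides differ as pairs only: `t₁` and `t₂` may coincide, and so may `o₁` and `o₂`.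
  record Arc (c : List A) : Set where
    field
      t₁ o₁ t₂ o₂ : A
      Tt₁   : T t₁
      To₁   : ¬ T o₁
      Tt₂   : T t₂
      To₂   : ¬ T o₂
      side₁ : Side c t₁ o₁
      side₂ : Side c t₂ o₂
      e₁≢e₂ : (t₁ , o₁) ≢ (t₂ , o₂)
      only  : ∀ {t o} → T t → ¬ T o → Side c t o → (t , o) ≡ (t₁ , o₁) ⊎ (t , o) ≡ (t₂ , o₂)
      outside : ∀ {u v} → u ∈ c → ¬ T u → v ∈ c → ¬ T v →
        Star (λ x y → Side c x y × ¬ T x × ¬ T y) u v
  open Arc

  Arc-resp-↻ : ∀ {c c′} → c ↻ c′ → Arc c → Arc c′
  Arc-resp-↻ r arc = record
    { Tt₁ = Tt₁ arc ; To₁ = To₁ arc ; Tt₂ = Tt₂ arc ; To₂ = To₂ arc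
    ; side₁ = Side-resp-↻ r (side₁ arc) ; side₂ = Side-resp-↻ r (side₂ arc)
    ; e₁≢e₂ = e₁≢e₂ arc
    ; only = λ t o s → only arc t o (Side-resp-↻ (↻-sym r) s)
    ; outside = λ u ¬u v ¬v → Star.map (λ (s , ¬x , ¬y) → Side-resp-↻ r s , ¬x , ¬y)
        (outside arc (∈-resp-↭ (↭-sym (proj₁ r)) u) ¬u (∈-resp-↭ (↭-sym (proj₁ r)) v) ¬v)
    }

  first-out : ∀ X {o} → ¬ T o → ∃₂ λ X₁ o₁ → ∃₂ λ X₂ r₀ →
    X ∷ʳ o ≡ X₁ ++ o₁ ∷ X₂ × All T X₁ × ¬ T o₁ × o₁ ∷ X₂ ≡ r₀ ∷ʳ o
  first-out [] {o} ¬To = [] , o , [] , [] , refl , [] , ¬To , refl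
  first-out (x ∷ X) {o} ¬To with T? x
  ... | no ¬Tx = [] , x , X ∷ʳ o , x ∷ X , refl , [] , ¬Tx , refl
  ... | yes Tx with first-out X ¬To
  ... | X₁ , o₁ , X₂ , r₀ , e , a , ¬To₁ , e′ = x ∷ X₁ , o₁ , X₂ , r₀ , cong (x ∷_) e , Tx ∷ a , ¬To₁ , e′

  last-out : ∀ {y} xs → y ∈ xs → ¬ T y → ∃₂ λ X o → ∃ λ Y → xs ≡ X ++ o ∷ Y × ¬ T o × All T Y
  last-out (x ∷ xs) y∈ ¬Ty with All.all? T? xs
  last-out (x ∷ xs) (here refl) ¬Ty | yes a = [] , x , xs , refl , ¬Ty , a
  last-out (x ∷ xs) (there y∈) ¬Ty | yes a = ⊥-elim (¬Ty (All.lookup a y∈))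
  ... | no ¬a with find (All.¬All⇒Any¬ T? xs ¬a)
  ... | z , z∈ , ¬Tz with last-out xs z∈ ¬Tz
  ... | X , o , Y , e , ¬To , a = x ∷ X , o , Y , cong (x ∷_) e , ¬To , a

  -- Of `r` only the two ends are assumed to be outside `T`. A vertex of `T` within `r` would be
  -- joined to `t₂` by a path in `T` along the cycle; but such a path cannot leave `p`, whose only
  -- exits lead to `o₁` and `o₂`. The equations present `p` and `r` by both their first and last
  -- entries.
  arc-++ : ∀ {p r t₁ o₁ t₂ o₂ p′ p₀ r′ r₀} →
    p ≡ t₂ ∷ p′ → p ≡ p₀ ∷ʳ t₁ → r ≡ o₁ ∷ r′ → r ≡ r₀ ∷ʳ o₂ →
    Unique (p ++ r) → 3 ≤ length (p ++ r) → All T p → ¬ T o₁ → ¬ T o₂ →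
    (∀ {u v} → u ∈ p ++ r → v ∈ p ++ r → T u → T v → ∃ λ P → head P ≡ just u × last P ≡ just v ×
      (∀ {x y} → (x , y) ∈ pairs P → Side (p ++ r) x y × T y)) →
    Arc (p ++ r)
  arc-++ {p} {r} {t₁} {o₁} {t₂} {o₂} {p′} {p₀} {r′} {r₀} pt₂ pt₁ ro₁ ro₂ u 3≤ allT ¬To₁ ¬To₂ conn = record
    { t₁ = t₁ ; o₁ = o₁ ; t₂ = t₂ ; o₂ = o₂
    ; Tt₁ = inT t₁∈ ; To₁ = ¬To₁ ; Tt₂ = inT t₂∈ ; To₂ = ¬To₂
    ; side₁ = inj₁ (fromᶜ (∈-++⁺ʳ (pairs p) (here refl)))
    ; side₂ = inj₂ (fromᶜ (∈-++⁺ʳ (pairs p) (there (∈-++⁺ʳ (pairs r) (here refl)))))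
    ; e₁≢e₂ = distinct
    ; only = only′
    ; outside = λ i ¬i j ¬j → star-along (λ (s , a , b) → ⊎-swap s , b , a) r
        (λ e → inj₁ (fromᶜ (∈-++⁺ʳ (pairs p) (there (∈-++⁺ˡ e)))) ,
               outT (proj₁ (pairs⊆ r e)) , outT (proj₂ (pairs⊆ r e)))
        (in-r i ¬i) (in-r j ¬j)
    }
    where
    c = p ++ r
    eqᶜ : cpairs c ≡ pairs p ++ (t₁ , o₁) ∷ pairs r ++ [ (o₂ , t₂) ]
    eqᶜ = trans close (trans join (cong (λ l → pairs p ++ (t₁ , o₁) ∷ l) tail-r))
      where
      close : cpairs (p ++ r) ≡ pairs (p ++ (r ∷ʳ t₂))
      close = trans (cong (λ p → cpairs (p ++ r)) pt₂)
        (cong pairs (trans (cong (λ p → (p ++ r) ∷ʳ t₂) (sym pt₂)) (++-assoc p r [ t₂ ])))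
      join : pairs (p ++ (r ∷ʳ t₂)) ≡ pairs p ++ (t₁ , o₁) ∷ pairs (r ∷ʳ t₂)
      join rewrite pt₁ | ro₁ = pairs-∷ʳ∷ p₀ t₁ o₁ (r′ ∷ʳ t₂)
      tail-r : pairs (r ∷ʳ t₂) ≡ pairs r ++ [ (o₂ , t₂) ]
      tail-r rewrite ro₂ = pairs-∷ʳ∷ r₀ o₂ t₂ []
    fromᶜ : ∀ {e} → e ∈ pairs p ++ (t₁ , o₁) ∷ pairs r ++ [ (o₂ , t₂) ] → e ∈ cpairs c
    fromᶜ {e} = subst (e ∈_) (sym eqᶜ)
    data Kind : A → A → Set where
      inside-p : ∀ {x y} → x ∈ p → y ∈ p → Kind x y
      exit     : Kind t₁ o₁
      inside-r : ∀ {x y} → x ∈ r → y ∈ r → Kind x y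
      enter    : Kind o₂ t₂
    kind : ∀ {x y} → (x , y) ∈ cpairs c → Kind x y
    kind {x} {y} i with ∈-++⁻ (pairs p) (subst ((x , y) ∈_) eqᶜ i)
    ... | inj₁ j = let a , b = pairs⊆ p j in inside-p a b
    ... | inj₂ (here refl) = exit
    ... | inj₂ (there j) with ∈-++⁻ (pairs r) j
    ...   | inj₁ k = let a , b = pairs⊆ r k in inside-r a b
    ...   | inj₂ (here refl) = enter
    t₁∈ : t₁ ∈ p
    t₁∈ = subst (t₁ ∈_) (sym pt₁) (∈-++⁺ʳ p₀ (here refl))
    t₂∈ : t₂ ∈ p
    t₂∈ = subst (t₂ ∈_) (sym pt₂) (here refl)
    inT : ∀ {x} → x ∈ p → T x
    inT = All.lookup allT
    disjoint : ∀ {x} → x ∈ p → x ∉ r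
    disjoint = unique-disjoint p u
    step : ∀ {x y} → Side c x y × T y → x ∈ p → y ∈ p
    step (inj₁ e , Ty) x∈ with kind e
    ... | inside-p _ y∈ = y∈
    ... | exit = ⊥-elim (¬To₁ Ty)
    ... | inside-r x∈r _ = ⊥-elim (disjoint x∈ x∈r)
    ... | enter = t₂∈
    step (inj₂ e , Ty) x∈ with kind e
    ... | inside-p y∈ _ = y∈
    ... | exit = t₁∈
    ... | inside-r _ x∈r = ⊥-elim (disjoint x∈ x∈r)
    ... | enter = ⊥-elim (¬To₂ Ty)
    outT : ∀ {x} → x ∈ r → ¬ T x
    outT x∈ Tx with conn (∈-++⁺ˡ t₂∈) (∈-++⁺ʳ p x∈) (inT t₂∈) Tx
    ... | P , hd , lst , P-ok =
      disjoint (path-preserves {S = _∈ p} P hd lst (step ∘ P-ok) t₂∈) x∈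
    in-r : ∀ {x} → x ∈ c → ¬ T x → x ∈ r
    in-r x∈ ¬Tx = [ (λ i → ⊥-elim (¬Tx (inT i))) , id ]′ (∈-++⁻ p x∈)
    only′ : ∀ {t o} → T t → ¬ T o → Side c t o → (t , o) ≡ (t₁ , o₁) ⊎ (t , o) ≡ (t₂ , o₂)
    only′ Tt ¬To (inj₁ e) with kind e
    ... | inside-p _ o∈ = ⊥-elim (¬To (inT o∈))
    ... | exit = inj₁ refl
    ... | inside-r t∈ _ = ⊥-elim (outT t∈ Tt)
    ... | enter = ⊥-elim (¬To₂ Tt)
    only′ Tt ¬To (inj₂ e) with kind e
    ... | inside-p o∈ _ = ⊥-elim (¬To (inT o∈))
    ... | exit = ⊥-elim (¬To₁ Tt)
    ... | inside-r _ t∈ = ⊥-elim (outT t∈ Tt)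
    ... | enter = inj₂ refl
    -- If the two crossings agreed, `p` and `r` would be singletons and the cycle would have length
    -- two.
    distinct : (t₁ , o₁) ≢ (t₂ , o₂)
    distinct refl = 3≰2 (subst (λ c → 3 ≤ length c) short 3≤)
      where
      p≡ : p ≡ [ t₁ ]
      p≡ = trans pt₂ (cong (t₁ ∷_) (∷≡∷ʳ-unique (subst Unique pt₂ (Unique-++ˡ p u)) (trans (sym pt₂) pt₁)))
      ur : Unique r
      ur = Unique-++ˡ r (Unique-resp-↭ (++-comm p r) u)
      r≡ : r ≡ [ o₁ ]
      r≡ = trans ro₁ (cong (o₁ ∷_) (∷≡∷ʳ-unique (subst Unique ro₁ ur) (trans (sym ro₁) ro₂)))
      short : p ++ r ≡ t₁ ∷ o₁ ∷ []
      short = cong₂ _++_ p≡ r≡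
      3≰2 : ¬ 3 ≤ 2
      3≰2 (s≤s (s≤s ()))

  -- The run of `T` through `t` may wrap past the end of the list. Hence the part `Y` after the last
  -- vertex outside `T` is moved to the front, where it continues up to the first vertex outside
  -- `T`.
  arc : ∀ {c} → Unique c → 3 ≤ length c → ∀ {t o} → t ∈ c → T t → o ∈ c → ¬ T o →
    (∀ {u v} → u ∈ c → v ∈ c → T u → T v → ∃ λ P → head P ≡ just u × last P ≡ just v ×
      (∀ {x y} → (x , y) ∈ pairs P → Side c x y × T y)) →
    Arc c
  arc {c} u 3≤ {t} {o} t∈ Tt o∈ ¬To conn with rotate-to t∈
  ... | c₁ , rot₁ with last-out c₁ (tail-∈ (∈-resp-↭ (proj₁ rot₁) o∈)) ¬To
    where
    tail-∈ : o ∈ t ∷ c₁ → o ∈ c₁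
    tail-∈ (here refl) = ⊥-elim (¬To Tt)
    tail-∈ (there i) = i
  ... | X , o₂ , Y , refl , ¬To₂ , allY with first-out (t ∷ X) ¬To₂
  ... | [] , .t , X₂ , r₀ , refl , allX , ¬To₁ , r≡ = ⊥-elim (¬To₁ Tt)
  ... | x₁ ∷ X₁ , o₁ , X₂ , r₀ , eq , allX , ¬To₁ , r≡ =
    Arc-resp-↻ (↻-sym rot) (build (head-split Y x₁ X₁) (last-split Y x₁ X₁))
    where
    p = Y ++ x₁ ∷ X₁
    r = o₁ ∷ X₂
    rot : c ↻ (p ++ r)
    rot = ↻-trans rot₁ (subst₂ _↻_
      (++-assoc (t ∷ X) [ o₂ ] Y)
      (trans (cong (Y ++_) eq) (sym (++-assoc Y (x₁ ∷ X₁) r)))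
      (rotate ((t ∷ X) ∷ʳ o₂) Y))
    head-split : ∀ Y (x : A) X → ∃₂ λ h p′ → Y ++ x ∷ X ≡ h ∷ p′
    head-split [] x X = x , X , refl
    head-split (y ∷ Y) x X = y , Y ++ x ∷ X , refl
    last-split : ∀ Y (x : A) X → ∃₂ λ p₀ l → Y ++ x ∷ X ≡ p₀ ∷ʳ l
    last-split Y x X with initLast X
    ... | [] = Y , x , refl
    ... | X′ ∷ʳ′ l = Y ++ x ∷ X′ , l , sym (++-assoc Y (x ∷ X′) [ l ])
    back : ∀ {x} → x ∈ p ++ r → x ∈ c
    back = ∈-resp-↭ (↭-sym (proj₁ rot))
    build : (∃₂ λ h p′ → p ≡ h ∷ p′) → (∃₂ λ p₀ l → p ≡ p₀ ∷ʳ l) → Arc (p ++ r)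
    build (_ , _ , e) (_ , _ , e′) = arc-++ e e′ refl r≡ (Unique-resp-↭ (proj₁ rot) u)
      (≤-trans 3≤ (≤-reflexive (↭-length (proj₁ rot)))) (All.++⁺ allY allX) ¬To₁ ¬To₂
      λ i j Tu Tv → let P , hd , lst , ok = conn (back i) (back j) Tu Tv in
        P , hd , lst , λ k → let s , Ty = ok k in Side-resp-↻ rot s , Ty

unique-⇔⇒↭ : {xs ys : List A} → Unique xs → Unique ys → (∀ {x} → x ∈ xs ⇔ x ∈ ys) → xs ↭ ys
unique-⇔⇒↭ u v iff = ∼bag⇒↭ (unique∧set⇒bag u v iff)

step-out : {R : A → A → Set} {S : A → Set} → (∀ x → Dec (S x)) → ∀ {u v} → Star R u v → S u → ¬ S v →
  ∃₂ λ a b → S a × ¬ S b × R a b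
step-out S? ε Su ¬Sv = ⊥-elim (¬Sv Su)
step-out S? (_◅_ {j = j} r rs) Su ¬Sv with S? j
... | yes Sj = step-out S? rs Sj ¬Sv
... | no ¬Sj = _ , _ , Su , ¬Sj , r

-- Trees

module _ {m n : ℕ} (K : Map m n) where

  private
    _∈?_ = DecMem._∈?_ (_≟F_ {m})

  -- An inductive form of trees, each step attaching a leaf `b`. Either orientation of the new edge
  -- is allowed because edge lists store an arbitrary one.
  data Grown : List (Fin m) → List (Fin m × Fin m) → Set where
    root : ∀ r → Grown [ r ] []
    grow : ∀ {Vs Es a b e} → Grown Vs Es → a ∈ Vs → b ∉ Vs → Adj K a b →
      e ≡ (a , b) ⊎ e ≡ (b , a) → Grown (b ∷ Vs) (e ∷ Es)

  Adj-sym : ∀ {a b} → Adj K a b → Adj K b a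
  Adj-sym (f , p) = f , ⊎-swap p

  grown-ends : ∀ {Vs Es} → Grown Vs Es → ∀ {x y} → (x , y) ∈ Es → x ∈ Vs × y ∈ Vs
  grown-ends (grow g a∈ b∉ adj (inj₁ refl)) (here refl) = there a∈ , here refl
  grown-ends (grow g a∈ b∉ adj (inj₂ refl)) (here refl) = here refl , there a∈
  grown-ends (grow g a∈ b∉ adj e≡) (there i) = let x , y = grown-ends g i in there x , there y

  grown-edge-ends : ∀ {Vs Es} → Grown Vs Es → ∀ {x y} → EdgeOf K Es x y → x ∈ Vs × y ∈ Vs
  grown-edge-ends g (inj₁ e) = grown-ends g e
  grown-edge-ends g (inj₂ e) = let x , y = grown-ends g e in y , x

  grown-unique : ∀ {Vs Es} → Grown Vs Es → Unique Vs
  grown-unique (root r) = [] ∷ []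
  grown-unique (grow g _ b∉ _ _) = ∉⇒Unique b∉ (grown-unique g)

  grown-unique-edges : ∀ {Vs Es} → Grown Vs Es → Unique Es
  grown-unique-edges (root r) = []
  grown-unique-edges (grow g a∈ b∉ _ (inj₁ refl)) =
    ∉⇒Unique (λ i → b∉ (proj₂ (grown-ends g i))) (grown-unique-edges g)
  grown-unique-edges (grow g a∈ b∉ _ (inj₂ refl)) =
    ∉⇒Unique (λ i → b∉ (proj₁ (grown-ends g i))) (grown-unique-edges g)

  grown-length : ∀ {Vs Es} → Grown Vs Es → length Vs ≡ suc (length Es)
  grown-length (root r) = refl
  grown-length (grow g _ _ _ _) = cong suc (grown-length g)

  module _ {Vs : List (Fin m)} {Es : List (Fin m × Fin m)} (tree : IsTree K Vs Es) where

    private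
      uVs  = proj₁ tree
      1≤   = proj₁ (proj₂ tree)
      EL   = proj₁ (proj₂ (proj₂ tree))
      ends = proj₁ (proj₂ (proj₂ (proj₂ tree)))
      size = proj₁ (proj₂ (proj₂ (proj₂ (proj₂ tree))))
      conn = proj₂ (proj₂ (proj₂ (proj₂ (proj₂ tree))))

    -- `k` is fuel bounding the number of vertices still missing. While one is missing, a connecting
    -- path in the tree has an edge leaving the grown part.
    grow-all : ∀ k {Vs′ Es′} → Grown Vs′ Es′ → Vs′ ⊆ Vs → Es′ ⊆ Es → length Vs ≤ k + length Vs′ →
      ∃₂ λ Vs″ Es″ → Grown Vs″ Es″ × Vs″ ⊆ Vs × Es″ ⊆ Es × Vs ⊆ Vs″
    grow-all k {Vs′} {Es′} g V⊆ E⊆ l with All.all? (_∈? Vs′) Vs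
    ... | yes a = _ , _ , g , V⊆ , E⊆ , All.lookup a
    ... | no ¬a with find (All.¬All⇒Any¬ (_∈? Vs′) Vs ¬a)
    grow-all zero g V⊆ E⊆ l | no ¬a | v , v∈ , v∉ =
      ⊥-elim (<⇒≱ (unique-⊆⇒≤ (∉⇒Unique v∉ (grown-unique g))
        (λ { (here refl) → v∈ ; (there i) → V⊆ i })) l)
    grow-all (suc k) {Vs′} {Es′} g V⊆ E⊆ l | no ¬a | v , v∈ , v∉ with a-vertex g
      where
      a-vertex : ∀ {Vs Es} → Grown Vs Es → ∃ λ r → r ∈ Vs
      a-vertex (root r) = r , here refl
      a-vertex (grow {b = b} _ _ _ _ _) = b , here refl
    ... | r , r∈ with step-out (_∈? Vs′) (conn r v (V⊆ r∈) v∈) r∈ v∉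
    ... | a , b , a∈ , b∉ , inj₁ e = grow-all k (grow g a∈ b∉ (proj₁ (proj₂ EL a b e)) (inj₁ refl))
        (λ { (here refl) → proj₂ (ends a b e) ; (there i) → V⊆ i })
        (λ { (here refl) → e ; (there i) → E⊆ i })
        (≤-trans l (≤-reflexive (sym (+-suc k _))))
    ... | a , b , a∈ , b∉ , inj₂ e = grow-all k (grow g a∈ b∉ (Adj-sym (proj₁ (proj₂ EL b a e))) (inj₂ refl))
        (λ { (here refl) → proj₁ (ends b a e) ; (there i) → V⊆ i })
        (λ { (here refl) → e ; (there i) → E⊆ i })
        (≤-trans l (≤-reflexive (sym (+-suc k _))))

    -- Acyclicity enters through the edge count: once all vertices are reached, the grown tree has
    -- `length Vs ∸ 1` edges, all from `Es`, so none is left over.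
    tree-grown : ∃₂ λ Vs′ Es′ → Grown Vs′ Es′ × Vs′ ↭ Vs × Es′ ↭ Es
    tree-grown = done (grow-all (length Vs) (root _) (λ { (here refl) → proj₂ (some Vs 1≤) }) (λ ())
                   (≤-trans (≤-reflexive (sym (+-identityʳ _))) (+-monoʳ-≤ (length Vs) z≤n)))
      where
      some : ∀ (xs : List (Fin m)) → 1 ≤ length xs → ∃ λ x → x ∈ xs
      some (x ∷ _) _ = x , here refl
      done : (∃₂ λ Vs″ Es″ → Grown Vs″ Es″ × Vs″ ⊆ Vs × Es″ ⊆ Es × Vs ⊆ Vs″) →
        ∃₂ λ Vs′ Es′ → Grown Vs′ Es′ × Vs′ ↭ Vs × Es′ ↭ Es
      done (Vs′ , Es′ , g , V⊆ , E⊆ , V⊇) = Vs′ , Es′ , g , pV ,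
          unique-⇔⇒↭ (grown-unique-edges g) (proj₁ EL) (mk⇔ E⊆ (λ i → E⊇ _ i (_ ∈ₚ? Es′)))
        where
        pV : Vs′ ↭ Vs
        pV = unique-⇔⇒↭ (grown-unique g) uVs (mk⇔ V⊆ V⊇)
        len : length Es ≡ length Es′
        len = trans size (cong (_∸ 1) (trans (sym (↭-length pV)) (grown-length g)))
        E⊇ : ∀ e → e ∈ Es → Dec (e ∈ Es′) → e ∈ Es′
        E⊇ e i (yes j) = j
        E⊇ e i (no ¬j) = ⊥-elim (<⇒≱ (unique-⊆⇒≤ (∉⇒Unique ¬j (grown-unique-edges g))
          (λ { (here refl) → i ; (there j) → E⊆ j })) (≤-reflexive len))

-- The closed walk around a tree

module Boundary {n nf : ℕ} (M : Map n nf) (K : Map nf n)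
  (isMap : IsMap M) (polyhedral : Polyhedral M) (dual : IsDual M K) where

  open Dual M K isMap polyhedral dual

  degree-length : ∀ {b os} → Unique os → (∀ {o} → o ∈ os ⇔ Adj K b o) → length os ≡ degree K b
  degree-length {b} u iff = ↭-length (unique-⇔⇒↭ u (Unique.filter⁺ (adj? K b) (Unique.allFin⁺ nf))
    (mk⇔ (λ i → ∈-filter⁺ (adj? K b) (∈-allFin _) (to iff i))
         (λ i → from iff (proj₂ (∈-filter⁻ (adj? K b) {xs = allFin nf} i)))))

  -- The end `o` may itself belong to the tree; a chord then counts once from each end.
  Leaves : List (Fin nf) → List (Fin nf × Fin nf) → Fin nf → Fin nf → Set
  Leaves Vs Es t o = t ∈ Vs × Adj K t o × ¬ EdgeOf K Es t o

  -- In `count`, every one of the tree edges accounts for the two darts that the degree sum counts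
  -- and the walk omits. The additive form avoids a truncated subtraction.
  record Around (Vs : List (Fin nf)) (Es : List (Fin nf × Fin nf)) : Set where
    field
      base   : Fin n
      ds     : List (Fin nf × Fin nf)
      walk   : Walk (Link K) base ds base
      unique : Unique ds
      leaves : ∀ {t o} → (t , o) ∈ ds ⇔ Leaves Vs Es t o
      count  : length ds + 2 * (length Vs ∸ 1) ≡ sum (map (degree K) Vs)

  -- A new leaf b attached at a replaces the dart (a , b) in the boundary walk
  -- by the walk around b that avoids the edge b a.
  around : ∀ {Vs Es} → Grown K Vs Es → Around Vs Es
  around (root r) with star r
  ... | F , os , w , u , iff = record
    { base = F ; ds = map (r ,_) os ; walk = mapʷ id w
    ; unique = Unique.map⁺ ,-injectiveʳ u
    ; leaves = mk⇔ fwd bwd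
    ; count = trans (+-identityʳ _) (trans (length-map (r ,_) os)
        (trans (degree-length u iff) (sym (+-identityʳ _))))
    }
    where
    fwd : ∀ {t o} → (t , o) ∈ map (r ,_) os → Leaves [ r ] [] t o
    fwd i with ∈-map⁻ (r ,_) i
    ... | o , o∈ , refl = here refl , to iff o∈ , λ { (inj₁ ()) ; (inj₂ ()) }
    bwd : ∀ {t o} → Leaves [ r ] [] t o → (t , o) ∈ map (r ,_) os
    bwd (here refl , adj , _) = ∈-map⁺ (r ,_) (from iff adj)
  around (grow {Vs} {Es} {a} {b} {e} g a∈ b∉ adj e≡) = insert (around g)
    where
    insert : Around Vs Es → Around (b ∷ Vs) (e ∷ Es)
    insert A with ∈-∃++ (from (Around.leaves A) (a∈ , adj , b∉ ∘ proj₂ ∘ grown-edge-ends K g))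
    ... | X , Y , ds≡ with split X (subst (λ ds → Walk (Link K) _ ds _) ds≡ (Around.walk A))
    ... | I , w₁ , l ∷ w₂ with open-star (Adj-sym K adj) l
    ... | os , w , u@(_ ∷ u-os) , iff = record
      -- The old closed walk is rotated to begin at `I`, just before the dart from `a` to `b`, so
      -- that the detour around `b` comes first.
      { base = I ; ds = new ; walk = w ++ʷ w₂ ++ʷ w₁
      ; unique = Unique.++⁺ (Unique.map⁺ ,-injectiveʳ u-os) u-old
          (λ (i , j) → old-source j (new-source i))
      ; leaves = mk⇔ fwd bwd
      ; count = total
      }
      where
      old = Y ++ X
      new = map (b ,_) os ++ old
      perm : Around.ds A ↭ (a , b) ∷ old
      perm = ↭-trans (↭-reflexive ds≡) (↭-trans (shift (a , b) X Y) (prep _ (++-comm X Y)))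
      u-all : Unique ((a , b) ∷ old)
      u-all = Unique-resp-↭ perm (Around.unique A)
      u-old : Unique old
      u-old with u-all
      ... | _ ∷ v = v
      old-leaf : ∀ {t o} → (t , o) ∈ old → Leaves Vs Es t o
      old-leaf i = to (Around.leaves A) (∈-resp-↭ (↭-sym perm) (there i))
      new-source : ∀ {t o} → (t , o) ∈ map (b ,_) os → t ≡ b
      new-source i with ∈-map⁻ (b ,_) i
      ... | _ , _ , refl = refl
      old-source : ∀ {t o} → (t , o) ∈ old → t ≢ b
      old-source i refl = b∉ (proj₁ (old-leaf i))
      edge : EdgeOf K (e ∷ Es) a b
      edge = [ inj₁ ∘ here ∘ sym , inj₂ ∘ here ∘ sym ]′ e≡
      edge⁻ : ∀ {x y} → EdgeOf K (e ∷ Es) x y →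
        (x ≡ a × y ≡ b) ⊎ (x ≡ b × y ≡ a) ⊎ EdgeOf K Es x y
      edge⁻ = go e≡
        where
        go : ∀ {x y} → e ≡ (a , b) ⊎ e ≡ (b , a) → EdgeOf K (e ∷ Es) x y →
          (x ≡ a × y ≡ b) ⊎ (x ≡ b × y ≡ a) ⊎ EdgeOf K Es x y
        go (inj₁ refl) (inj₁ (here refl)) = inj₁ (refl , refl)
        go (inj₁ refl) (inj₂ (here refl)) = inj₂ (inj₁ (refl , refl))
        go (inj₂ refl) (inj₁ (here refl)) = inj₂ (inj₁ (refl , refl))
        go (inj₂ refl) (inj₂ (here refl)) = inj₁ (refl , refl)
        go _ (inj₁ (there i)) = inj₂ (inj₂ (inj₁ i))
        go _ (inj₂ (there i)) = inj₂ (inj₂ (inj₂ i))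
      fwd : ∀ {t o} → (t , o) ∈ new → Leaves (b ∷ Vs) (e ∷ Es) t o
      fwd i with ∈-++⁻ (map (b ,_) os) i
      fwd i | inj₁ j with ∈-map⁻ (b ,_) j
      ... | o , o∈ , refl = here refl , to iff (there o∈) , not ∘ edge⁻
        where
        not : (b ≡ a × o ≡ b) ⊎ (b ≡ b × o ≡ a) ⊎ EdgeOf K Es b o → ⊥
        not (inj₁ (refl , _)) = b∉ a∈
        not (inj₂ (inj₁ (_ , refl))) = head∉ u o∈
        not (inj₂ (inj₂ x)) = b∉ (proj₁ (grown-edge-ends K g x))
      fwd {t} {o} i | inj₂ j with old-leaf j
      ... | t∈ , t~o , ¬to = there t∈ , t~o , not ∘ edge⁻
        where
        not : (t ≡ a × o ≡ b) ⊎ (t ≡ b × o ≡ a) ⊎ EdgeOf K Es t o → ⊥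
        not (inj₁ (refl , refl)) = head∉ u-all j
        not (inj₂ (inj₁ (refl , _))) = b∉ t∈
        not (inj₂ (inj₂ x)) = ¬to x
      bwd : ∀ {t o} → Leaves (b ∷ Vs) (e ∷ Es) t o → (t , o) ∈ new
      bwd (here refl , b~o , ¬bo) with from iff b~o
      ... | here refl = ⊥-elim (¬bo (⊎-swap edge))
      ... | there i = ∈-++⁺ˡ (∈-map⁺ (b ,_) i)
      bwd (there t∈ , t~o , ¬to)
        with ∈-resp-↭ perm (from (Around.leaves A) (t∈ , t~o , ¬to ∘ [ inj₁ ∘ there , inj₂ ∘ there ]′))
      ... | here refl = ⊥-elim (¬to edge)
      ... | there i = ∈-++⁺ʳ (map (b ,_) os) i
      total : length new + 2 * length Vs ≡ degree K b + sum (map (degree K) Vs)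
      total = begin
        length new + 2 * length Vs
          ≡⟨ cong₂ (λ x y → x + 2 * y) len-new (grown-length K g) ⟩
        (length os + length old) + 2 * suc (length Es)
          ≡⟨ solve 3 (λ x y z → (x :+ y) :+ con 2 :* (con 1 :+ z)
               := (con 1 :+ x) :+ ((con 1 :+ y) :+ con 2 :* z)) refl
               (length os) (length old) (length Es) ⟩
        suc (length os) + (suc (length old) + 2 * length Es)
          ≡⟨ cong₂ (λ x y → x + (y + 2 * length Es)) (degree-length u iff) (sym (↭-length perm)) ⟩
        degree K b + (length (Around.ds A) + 2 * length Es)
          ≡⟨ cong (λ k → degree K b + (length (Around.ds A) + 2 * (k ∸ 1))) (sym (grown-length K g)) ⟩
        degree K b + (length (Around.ds A) + 2 * (length Vs ∸ 1))
          ≡⟨ cong (degree K b +_) (Around.count A) ⟩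
        degree K b + sum (map (degree K) Vs) ∎
        where
        open ≡-Reasoning
        open +-*-Solver
        len-new : length new ≡ length os + length old
        len-new = trans (length-++ (map (b ,_) os)) (cong (_+ length old) (length-map (b ,_) os))

-- Walks without repeated vertices

pairs⊆cpairs : {A : Set} (xs : List A) {e : A × A} → e ∈ pairs xs → e ∈ cpairs xs
pairs⊆cpairs (x ∷ xs) = go x xs
  where
  go : ∀ {z} y ys {e} → e ∈ pairs (y ∷ ys) → e ∈ pairs ((y ∷ ys) ∷ʳ z)
  go y (y′ ∷ ys) (here e) = here e
  go y (y′ ∷ ys) (there i) = there (go y′ ys i)

module _ {V D : Set} {L : V → D → V → Set} where

  Incident : V → D → Set
  Incident v d = ∃ λ w → L v d w ⊎ L w d v

  start-split : ∀ {u ds v} (w : Walk L u ds v) → ∀ {x} → x ∈ starts w →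
    ∃₂ λ ds₁ d → ∃ λ ds₂ → ds ≡ ds₁ ++ d ∷ ds₂ × Walk L u ds₁ x × ∃ (L x d)
  start-split (l ∷ w) (here refl) = [] , _ , _ , refl , [] , _ , l
  start-split (l ∷ w) (there i) with start-split w i
  ... | ds₁ , d , ds₂ , refl , w′ , l′ = _ ∷ ds₁ , d , ds₂ , refl , l ∷ w′ , l′

  last-step : ∀ {u d ds v} → Walk L u (d ∷ ds) v → ∃₂ λ e w → e ∈ d ∷ ds × L w e v
  last-step (l ∷ []) = _ , _ , here refl , l
  last-step (_ ∷ w@(_ ∷ _)) = let e , x , i , l = last-step w in e , x , there i , l

  -- A vertex visited twice is left along two edges and entered along a third.
  starts-unique : (∀ {v d} → ¬ L v d v) → ∀ {u ds v} (w : Walk L u ds v) → Unique ds →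
    (∀ {x d e f} → d ∈ ds → e ∈ ds → f ∈ ds → Incident x d → Incident x e → Incident x f →
      d ≢ e → d ≢ f → e ≢ f → ⊥) → Unique (starts w)
  starts-unique irr [] _ _ = []
  starts-unique irr {u} (_∷_ {d = d} l w) uds@(_ ∷ uds′) no3 =
    ∉⇒Unique fresh (starts-unique irr w uds′ λ i j k → no3 (there i) (there j) (there k))
    where
    fresh : u ∉ starts w
    fresh i with start-split w i
    ... | [] , d′ , ds₂ , refl , [] , _ , l′ = irr l
    ... | c ∷ ds₁ , d′ , ds₂ , refl , w′ , _ , l′ with last-step w′
    ... | e , _ , e∈ , le = no3 (here refl) (there (∈-++⁺ˡ e∈)) (there d′∈)
        (_ , inj₁ l) (_ , inj₂ le) (_ , inj₁ l′)
        (λ { refl → head∉ uds (∈-++⁺ˡ e∈) }) (λ { refl → head∉ uds d′∈ })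
        (λ { refl → unique-disjoint (c ∷ ds₁) uds′ e∈ (here refl) })
      where
      d′∈ : d′ ∈ (c ∷ ds₁) ++ d′ ∷ ds₂
      d′∈ = ∈-++⁺ʳ (c ∷ ds₁) (here refl)

  consecutive : ∀ {u ds v} (w : Walk L u ds v) → ∀ {x y} → (x , y) ∈ pairs (starts w ∷ʳ v) →
    ∃ λ d → d ∈ ds × L x d y
  consecutive (l ∷ []) (here refl) = _ , here refl , l
  consecutive (l ∷ l′ ∷ w) (here refl) = _ , here refl , l
  consecutive (l ∷ l′ ∷ w) (there i) = let d , j , k = consecutive (l′ ∷ w) i in d , there j , k

  cyclically-consecutive : ∀ {u ds} (w : Walk L u ds u) → ∀ {x y} → (x , y) ∈ cpairs (starts w) →
    ∃ λ d → d ∈ ds × L x d y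
  cyclically-consecutive (l ∷ w) = consecutive (l ∷ w)

-- From a proper tree to a proper graph of type II

module Forward {n nf : ℕ} (M : Map n nf) (K : Map nf n)
  (isMap : IsMap M) (polyhedral : Polyhedral M) (dual : IsDual M K)
  {Vs : List (Fin nf)} {Es : List (Fin nf × Fin nf)} (proper : ProperTree K Vs Es) where

  open Dual M K isMap polyhedral dual
  open Boundary M K isMap polyhedral dual
  open Arc

  private
    tree      = proj₁ proper
    degrees   = proj₁ (proj₂ proper)
    in-face   = proj₁ (proj₂ (proj₂ proper))
    short     = proj₂ (proj₂ (proj₂ proper))
    tree-ends = proj₁ (proj₂ (proj₂ (proj₂ tree)))
    tree-conn = proj₂ (proj₂ (proj₂ (proj₂ (proj₂ tree))))
    edge-list = proj₁ (proj₂ (proj₂ tree))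

    T : Fin nf → Set
    T = _∈ Vs

    T? : ∀ v → Dec (T v)
    T? v = DecMem._∈?_ _≟F_ v Vs

    edge? : ∀ a b → Dec (EdgeOf K Es a b)
    edge? a b = ((a , b) ∈ₚ? Es) ⊎-dec ((b , a) ∈ₚ? Es)

  edge-ends : ∀ {a b} → EdgeOf K Es a b → T a × T b
  edge-ends (inj₁ e) = tree-ends _ _ e
  edge-ends (inj₂ e) = let p , q = tree-ends _ _ e in q , p

  edge-adj : ∀ {a b} → EdgeOf K Es a b → Adj K a b
  edge-adj (inj₁ e) = proj₁ (proj₂ edge-list _ _ e)
  edge-adj (inj₂ e) = Adj-sym K (proj₁ (proj₂ edge-list _ _ e))

  -- Condition (3) as a contradiction: on a face of length `q`, a path with at least `q` vertices
  -- has at least `q - 1` edges. Truncated subtraction does no harm because `q` is at least 3.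
  no-long-path : ∀ {F} (P : List (Fin nf)) → BoundaryPath K F P →
    (∀ a b → (a , b) ∈ pairs P → EdgeOf K Es a b) → ¬ length (face K F) ≤ length P
  no-long-path {F} P bp ep long = absurd (proj₁ (K-polygonal F)) long (short F P bp ep)
    where
    absurd : ∀ {q l} → 3 ≤ q → q ≤ l → ¬ l ∸ 1 ≤ q ∸ 2
    absurd (s≤s (s≤s (s≤s _))) (s≤s q≤l) l≤ = <⇒≱ q≤l l≤

  -- If the side were not a tree edge, the path from condition (2) would avoid it and so run the
  -- long way round through all vertices of the face, against condition (3).
  induced-side : ∀ {F a b} → T a → T b → (a , b) ∈ cpairs (face K F) → EdgeOf K Es a b
  induced-side {F} {a} {b} Ta Tb ab with edge? a b
  ... | yes e = e
  ... | no ¬e with in-face F a b Ta Tb (proj₁ (cpairs⊆ (face K F) ab)) (proj₂ (cpairs⊆ (face K F) ab))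
  ... | P , bp , hd , lst , _ , ep = ⊥-elim (no-long-path P bp ep
    (long-way-round (proj₂ (K-polygonal F)) (proj₁ (K-polygonal F)) ab P hd lst (proj₂ bp _ _)
      λ i → (λ { refl → ¬e (ep _ _ i) }) , (λ { refl → ¬e (⊎-swap (ep _ _ i)) })))

  induced : ∀ {a b} → T a → T b → Adj K a b → EdgeOf K Es a b
  induced Ta Tb (_ , inj₁ e) = induced-side Ta Tb e
  induced Ta Tb (_ , inj₂ e) = ⊎-swap (induced-side Tb Ta e)

  -- If all vertices of a face were in the tree, its boundary without the closing side would be a
  -- tree path, since the tree is induced; condition (3) forbids its length.
  face-leaves-tree : ∀ F → ∃ λ o → o ∈ face K F × ¬ T o
  face-leaves-tree F with All.all? T? (face K F)
  ... | no ¬all = find (All.¬All⇒Any¬ T? (face K F) ¬all)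
  ... | yes all = ⊥-elim (no-long-path {F} (face K F)
    (proj₂ (K-polygonal F) , λ a b i → inj₁ (pairs⊆cpairs (face K F) i))
    (λ a b i → let p , q = pairs⊆ (face K F) i in
      induced (All.lookup all p) (All.lookup all q) (F , inj₁ (pairs⊆cpairs (face K F) i)))
    ≤-refl)

  arc-of : ∀ {F t} → t ∈ face K F → T t → Arc T T? (face K F)
  arc-of {F} t∈ Tt = let o , o∈ , ¬To = face-leaves-tree F in
    arc T T? (proj₂ (K-polygonal F)) (proj₁ (K-polygonal F)) t∈ Tt o∈ ¬To
      λ u∈ v∈ Tu Tv → let P , bp , hd , lst , allT , _ = in-face F _ _ Tu Tv u∈ v∈ in
        P , hd , lst , λ i → proj₂ bp _ _ i , All.lookup allT (proj₂ (pairs⊆ P i))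

  private
    grown = tree-grown K tree
    boundary = around (proj₁ (proj₂ (proj₂ grown)))
    Vs↭ = proj₁ (proj₂ (proj₂ (proj₂ grown)))
    Es↭ = proj₂ (proj₂ (proj₂ (proj₂ grown)))

  open Around boundary

  Cut : Fin nf → Fin nf → Set
  Cut t o = T t × ¬ T o × Adj K t o

  cut⇒ds : ∀ {t o} → Cut t o → (t , o) ∈ ds
  cut⇒ds (Tt , ¬To , adj) = from leaves (∈-resp-↭ (↭-sym Vs↭) Tt , adj ,
    λ e → ¬To (proj₂ (edge-ends ([ inj₁ ∘ ∈-resp-↭ Es↭ , inj₂ ∘ ∈-resp-↭ Es↭ ]′ e))))

  -- Chords disappear here: a dart with both ends in the tree would be a tree edge by `induced`.
  ds⇒cut : ∀ {t o} → (t , o) ∈ ds → Cut t o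
  ds⇒cut i with to leaves i
  ... | t∈ , adj , ¬e = Tt , (λ To → ¬e ([ inj₁ ∘ ∈-resp-↭ (↭-sym Es↭) , inj₂ ∘ ∈-resp-↭ (↭-sym Es↭) ]′
        (induced Tt To adj))) , adj
    where Tt = ∈-resp-↭ Vs↭ t∈

  ds-ends : ∀ {a b} → EdgeOf K ds a b → (T a × ¬ T b) ⊎ (T b × ¬ T a)
  ds-ends (inj₁ i) = let p , q , _ = ds⇒cut i in inj₁ (p , q)
  ds-ends (inj₂ i) = let p , q , _ = ds⇒cut i in inj₂ (p , q)

  -- Condition (1) is made for this: its term `2 * (length Vs ∸ 1)` cancels the one in `count`.
  length-ds : length ds ≡ n
  length-ds = +-cancelʳ-≡ (2 * (length Vs ∸ 1)) _ _ (trans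
    (cong (λ l → length ds + 2 * (l ∸ 1)) (sym (↭-length Vs↭)))
    (trans count (trans (sum-↭ (map⁺ (degree K) Vs↭)) degrees)))

  incident-∂ : ∀ {F d} → Incident {L = Link K} F d → OnB K F d
  incident-∂ (_ , inj₁ (_ , p , _)) = p
  incident-∂ (_ , inj₂ (_ , _ , p)) = p

  arc-at : ∀ {F d} → d ∈ ds → OnB K F d → Arc T T? (face K F)
  arc-at i p = arc-of (proj₁ (∂⊆ K p)) (proj₁ (ds⇒cut i))

  arc-darts : ∀ {F d} (α : Arc T T? (face K F)) → d ∈ ds → OnB K F d →
    d ≡ (t₁ α , o₁ α) ⊎ d ≡ (t₂ α , o₂ α)
  arc-darts α i p = let Tt , ¬To , _ = ds⇒cut i in only α Tt ¬To p

  faces : List (Fin n)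
  faces = starts walk

  faces-unique : Unique faces
  faces-unique = starts-unique (λ l → proj₁ l refl) walk unique no3
    where
    no3 : ∀ {F d e f} → d ∈ ds → e ∈ ds → f ∈ ds →
      Incident {L = Link K} F d → Incident {L = Link K} F e → Incident {L = Link K} F f →
      d ≢ e → d ≢ f → e ≢ f → ⊥
    no3 {F} i j k id ie if d≢e d≢f e≢f
      with ∈-pair (e₁≢e₂ α) d≢e (arc-darts α i (incident-∂ id)) (arc-darts α j (incident-∂ ie))
             (arc-darts α k (incident-∂ if))
      where α = arc-at i (incident-∂ id)
    ... | inj₁ f≡d = d≢f (sym f≡d)
    ... | inj₂ f≡e = e≢f (sym f≡e)

  length-faces : length faces ≡ n
  length-faces = trans (length-starts walk) length-ds

  all-faces : ∀ F → F ∈ faces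
  all-faces F with DecMem._∈?_ _≟F_ F faces
  ... | yes i = i
  ... | no ¬i = ⊥-elim (<⇒≱ (unique-⊆⇒≤ (∉⇒Unique ¬i faces-unique) (λ _ → ∈-allFin _))
    (≤-reflexive (trans (length-tabulate id) (sym length-faces))))

  -- `arc-of` needs a tree vertex on the face. Since the walk visits every face and leaves it
  -- through a cut edge, there always is one.
  face-arc : ∀ F → Arc T T? (face K F)
  face-arc F with start-split walk (all-faces F)
  ... | ds₁ , d , ds₂ , eq , _ , _ , _ , p , _ =
    arc-at (subst (d ∈_) (sym eq) (∈-++⁺ʳ ds₁ (here refl))) p

  admissible : Admissible K ds
  admissible = (unique , λ a b i → let Ta , ¬Tb , adj = ds⇒cut i in
                  adj , λ j → ¬Tb (proj₁ (ds⇒cut j))) ,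
    length-ds ,
    (λ F → let α = face-arc F in (t₁ α , o₁ α) , (t₂ α , o₂ α) ,
      cut⇒ds (Tt₁ α , To₁ α , F , side₁ α) , cut⇒ds (Tt₂ α , To₂ α , F , side₂ α) ,
      e₁≢e₂ α , side₁ α , side₂ α , λ e → arc-darts α) ,
    faces , length-faces , faces-unique ,
    λ F G i → let (a , b) , d∈ , l = cyclically-consecutive walk i in a , b , inj₁ d∈ , link-meet l

  Comp : Fin nf → Fin nf → Set
  Comp = CompAdj K ds

  edge⇒comp : ∀ {a b} → EdgeOf K Es a b → Comp a b
  edge⇒comp e = edge-adj e , λ d → let Ta , Tb = edge-ends e in
    [ (λ (_ , ¬Tb) → ¬Tb Tb) , (λ (_ , ¬Ta) → ¬Ta Ta) ]′ (ds-ends d)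

  comp-T : ∀ {a b} → Comp a b → T a → T b
  comp-T {b = b} (adj , ¬cut) Ta with T? b
  ... | yes Tb = Tb
  ... | no ¬Tb = ⊥-elim (¬cut (inj₁ (cut⇒ds (Ta , ¬Tb , adj))))

  star-T : ∀ {a b} → Star Comp a b → T a → T b
  star-T ε Ta = Ta
  star-T (c ◅ cs) Ta = star-T cs (comp-T c Ta)

  face-outside : ∀ F {u v} → u ∈ face K F → ¬ T u → v ∈ face K F → ¬ T v → Star Comp u v
  face-outside F i ¬Tu j ¬Tv = Star.map
    (λ (s , ¬Tx , ¬Ty) → (F , s) , λ d → [ ¬Tx ∘ proj₁ , ¬Ty ∘ proj₁ ]′ (ds-ends d))
    (outside (face-arc F) i ¬Tu j ¬Tv)

  -- The invariant carried along the walk to show that the complement of the tree is connected.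
  Reaches : Fin nf → Fin n → Set
  Reaches y F = ∀ {z} → z ∈ face K F → ¬ T z → Star Comp y z

  reaches-along : ∀ {y F es G} (w : Walk (Link K) F es G) → es ⊆ ds → Reaches y F →
    ∀ {H} → H ∈ starts w → Reaches y H
  reaches-along (l ∷ w) es⊆ r (here refl) = r
  reaches-along (_∷_ {v = G} (_ , p , q) w) es⊆ r (there i) =
    reaches-along w (es⊆ ∘ there)
      (λ z∈ ¬Tz → r (proj₂ (∂⊆ K p)) ¬To ◅◅ face-outside G (proj₂ (∂⊆ K q)) ¬To z∈ ¬Tz) i
    where ¬To = proj₁ (proj₂ (ds⇒cut (es⊆ (here refl))))

  typeII : ProperTypeII K ds
  typeII = admissible , x , y , (λ s → To₁ α (star-T s Tx)) ,
    (λ z → components z (T? z)) , Vs , Es , proper ,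
    (λ z → mk⇔ reach-T (λ s → star-T s Tx)) ,
    λ a b → mk⇔ (λ e → edge⇒comp e , reach-T (proj₁ (edge-ends e)))
                (λ (c , s) → let Ta = star-T s Tx in induced Ta (comp-T c Ta) (proj₁ c))
    where
    -- The representatives of the two components are the ends of one cut edge on the face where the
    -- walk starts, so that `Reaches` holds there for `y`.
    α = face-arc base
    x = t₁ α
    y = o₁ α
    Tx = Tt₁ α
    reach-T : ∀ {z} → T z → Star Comp x z
    reach-T Tz = Star.map edge⇒comp (tree-conn _ _ Tx Tz)
    on-some-face : ∀ z → ∃ λ F → z ∈ face K F
    on-some-face z with face M z in eq | proj₁ (proj₁ isMap z)
    ... | F ∷ _ | _ = F , ∈-dual⁻ (subst (F ∈_) (sym eq) (here refl))
    components : ∀ z → Dec (T z) → Star Comp x z ⊎ Star Comp y z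
    components z (yes Tz) = inj₁ (reach-T Tz)
    components z (no ¬Tz) = let F , z∈ = on-some-face z in
      inj₂ (reaches-along walk id
        (face-outside base (proj₂ (∂⊆ K {base} (side₁ α))) (To₁ α)) (all-faces F) z∈ ¬Tz)

theorem5 : {n nf : ℕ} (M : Map n nf) (K : Map nf n) →
    IsMap M → Polyhedral M → IsDual M K →
    (∃₂ λ (Vs : List (Fin nf)) (Es : List (Fin nf × Fin nf)) → ProperTree K Vs Es)
    ⇔ (∃ λ (E : List (Fin nf × Fin nf)) → ProperTypeII K E)
theorem5 M K isMap polyhedral dual = mk⇔
  (λ (Vs , Es , proper) → _ , Forward.typeII M K isMap polyhedral dual proper)
  -- A proper graph of type II has a proper tree as one of its components by definition.
  (λ (_ , _ , _ , _ , _ , _ , Vs , Es , proper , _) → Vs , Es , proper)
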